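{- Let $G$ be a finite simple graph with $m$ edges that has no isolated edge. Then $G$ has a weak edge-locating-dominating set of size at most $\frac{m}{2}$.
   Context: An isolated edge of $G$ is an edge both of whose ends have degree $1$ (i.e. a connected component isomorphic to $K_2$). For an edge $e$ of $G$, $N(e)$ denotes the set of edges of $G$ different from $e$ that share an end with $e$, and $N[e]=N(e)\cup\{e\}$. Two distinct edges $e,f$ are edge-twins if $N(e)=N(f)$ (open edge-twins) or $N[e]=N[f]$ (closed edge-twins). A set $D\subseteq E(G)$ is an edge-dominating set if every edge in $E(G)\setminus D$ shares an end with some edge of $D$. A weak edge-locating-dominating set of $G$ is an edge-dominating set $D$ such that for every pair of distinct edges $e,f\in E(G)\setminus D$ that are not edge-twins, $N(e)\cap D\neq N(f)\cap D$. -}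

module Defs where

open import Data.Nat using (ℕ; _*_; _≤_)
open import Data.Fin using (Fin; _<_; _≟_)
open import Data.Product using (_×_; _,_; proj₁; proj₂; Σ-syntax)
open import Data.Sum using (_⊎_)
open import Data.List using (List; length; filter)
open import Data.List.Membership.Propositional using (_∈_; _∉_)
open import Data.List.Relation.Unary.All using (All)
open import Data.List.Relation.Unary.Unique.Propositional using (Unique)
open import Relation.Nullary using (¬_; Dec)
open import Relation.Nullary.Decidable using (_⊎-dec_)
open import Relation.Binary.PropositionalEquality using (_≡_; _≢_)
open import Function.Bundles using (_⇔_)

-- An edge {u,v} on vertex set Fin n is stored as the ordered pair (u , v) with u < v.
Edge : ℕ → Set
Edge n = Fin n × Fin n

-- A finite simple graph on vertex set Fin n: a duplicate-free list of edges,
-- each stored as (u , v) with u < v (so no loops, and each unordered pair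
-- has a unique representation).
record SimpleGraph (n : ℕ) : Set where
  field
    edges   : List (Edge n)
    ordered : All (λ e → proj₁ e < proj₂ e) edges
    unique  : Unique edges
open SimpleGraph public

module _ {n : ℕ} (G : SimpleGraph n) where

  size : ℕ
  size = length (edges G)

  Incident : Fin n → Edge n → Set
  Incident v e = proj₁ e ≡ v ⊎ proj₂ e ≡ v

  incident? : (v : Fin n) (e : Edge n) → Dec (Incident v e)
  incident? v e = (proj₁ e ≟ v) ⊎-dec (proj₂ e ≟ v)

  degree : Fin n → ℕ
  degree v = length (filter (incident? v) (edges G))

  IsolatedEdge : Edge n → Set
  IsolatedEdge e = e ∈ edges G × degree (proj₁ e) ≡ 1 × degree (proj₂ e) ≡ 1

  NoIsolatedEdge : Set
  NoIsolatedEdge = ∀ e → ¬ IsolatedEdge e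

  ShareEnd : Edge n → Edge n → Set
  ShareEnd e f = Incident (proj₁ e) f ⊎ Incident (proj₂ e) f

  InN : Edge n → Edge n → Set
  InN e f = f ∈ edges G × f ≢ e × ShareEnd e f

  InN[] : Edge n → Edge n → Set
  InN[] e f = f ≡ e ⊎ InN e f

  EdgeTwins : Edge n → Edge n → Set
  EdgeTwins e f = (∀ g → InN e g ⇔ InN f g) ⊎ (∀ g → InN[] e g ⇔ InN[] f g)

  EdgeSubset : List (Edge n) → Set
  EdgeSubset D = All (λ d → d ∈ edges G) D × Unique D

  IsEdgeDominating : List (Edge n) → Set
  IsEdgeDominating D =
    ∀ e → e ∈ edges G → e ∉ D → Σ[ d ∈ Edge n ] (d ∈ D × ShareEnd e d)

  SameTrace : List (Edge n) → Edge n → Edge n → Set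
  SameTrace D e f = ∀ g → g ∈ D → (InN e g ⇔ InN f g)

  IsWeakELD : List (Edge n) → Set
  IsWeakELD D =
    EdgeSubset D × IsEdgeDominating D ×
    (∀ e f → e ∈ edges G → f ∈ edges G → e ∉ D → f ∉ D → e ≢ f →
       ¬ EdgeTwins e f → ¬ SameTrace D e f)

-- Induction on the number of edges, for graphs that may have isolated edges, which then need
-- not be dominated. If some vertex has degree 2 or 3, or if there is a K₄, then a few edges are
-- deleted, a set D′ is taken for the rest, and half of the deleted edges are added to D′: the
-- only pairs that can still be confused involve a deleted edge, or were twins before the
-- deleted edges were restored, and in each case another choice or another deletion succeeds.
-- Otherwise all degrees are 0, 1 or at least 4. In an orientation with almost equal in- and
-- outdegrees every vertex of degree at least 4 is the tail of two edges, and one of the two is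
-- chosen. Two edges with the same trace then close up, along chosen edges, to a K₄.

module Submission where

open import Defs
open import Data.Nat using (ℕ; _*_; _≤_)
open import Data.Product using (_×_; Σ-syntax)
open import Data.List using (List; length)

open import Data.Empty using (⊥; ⊥-elim)
open import Data.Fin as Fin using (Fin; zero)
import Data.Fin.Properties as Fin
open import Data.List using (allFin; []; _∷_; _++_; filter; map)
open import Data.List.Membership.Propositional using (_∈_; _∉_; find; lose)
open import Data.List.Membership.Propositional.Properties
  using (∈-allFin; ∈-∃++; ∈-map⁺; ∈-map⁻; ∈-filter⁺; ∈-filter⁻; ∈-++⁺ˡ; ∈-++⁺ʳ; ∈-++⁻)
open import Data.List.Properties using (length-++; length-map; filter-all; filter-accept; filter-reject)
open import Data.List.Relation.Binary.Pointwise as Pointwise using (Pointwise; []; _∷_)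
open import Data.List.Relation.Unary.All as All using (All; []; _∷_)
open import Data.List.Relation.Unary.AllPairs using ([]; _∷_)
open import Data.List.Relation.Unary.Any using (Any; here; there; any?)
open import Data.List.Relation.Unary.Unique.Propositional using (Unique)
import Data.List.Relation.Unary.Unique.Propositional.Properties as Unique
open import Data.Nat using (zero; suc; _+_; _<_; z≤n; s≤s) renaming (_≟_ to _≟ℕ_)
open import Data.Nat.Properties
  using (_≤?_; ≤-refl; ≤-reflexive; ≤-trans; ≤-total; m≤n+m; +-suc; +-mono-≤; +-monoʳ-≤; +-monoˡ-≤; *-distribˡ-+; +-commutativeSemigroup)
open import Algebra.Properties.CommutativeSemigroup +-commutativeSemigroup using (x∙yz≈y∙xz)
open import Data.Product using (_,_; proj₁; proj₂; ∃₂; swap)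
open import Data.Product.Properties using (≡-dec)
open import Data.Sum as Sum using (_⊎_; inj₁; inj₂)
open import Function using (_∘_; id; case_of_)
open import Function.Bundles using (Equivalence; mk⇔)
open import Relation.Binary.Definitions using (DecidableEquality)
open import Relation.Binary.PropositionalEquality using (_≡_; _≢_; refl; sym; trans; cong; subst; ≢-sym)
open import Relation.Nullary using (¬_; Dec; yes; no; ¬?)
open import Relation.Nullary.Decidable using (map′; _×-dec_; _⊎-dec_; _→-dec_)

-- Restored edges can separate edges that were twins without them, and `D′` need not tell such edges
-- apart. This is the obstacle at a vertex of degree 2 or 3. Two of its edges `g`, `h` are deleted,
-- and one and the same `D′` is tested with `h` and with `g`. The failures are contradictory, or
-- exhibit a vertex of degree 2 or a K₄ that can be treated instead, or let an edge of `D′` be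
-- exchanged, or call for another pair of edges at the vertex. The threshold 4 comes from the
-- orientation: indegree at most outdegree plus one makes the outdegree at least 2 from degree 4 on,
-- while degree 3 may leave outdegree 1. As every edge has one tail, choosing one of at least two
-- edges per tail takes at most half of them. K₄ needs a treatment of its own because the chosen
-- edges may form a 4-cycle, and its two diagonals then touch the same four chosen edges.

record Ends {V A : Set} (_∈ᵥ_ : V → A → Set) (e : A) (p q : V) : Set where
  constructor mkEnds
  field
    left     : p ∈ᵥ e
    right    : q ∈ᵥ e
    distinct : p ≢ q
    only     : ∀ {z} → z ∈ᵥ e → z ≡ p ⊎ z ≡ q

-- Orientations whose in- and outdegrees differ by at most one.

module Orientation {V : Set} (_≟_ : DecidableEquality V) where

  hits : V → V → ℕ
  hits v x with x ≟ v
  ... | yes _ = 1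
  ... | no  _ = 0

  out into : V → List (V × V) → ℕ
  out v []            = 0
  out v ((p , q) ∷ M) = hits v p + out v M
  into v []            = 0
  into v ((p , q) ∷ M) = hits v q + into v M

  out-middle : ∀ v M p q N → out v (M ++ (p , q) ∷ N) ≡ hits v p + out v (M ++ N)
  out-middle v [] p q N = refl
  out-middle v ((r , s) ∷ M) p q N = trans (cong (hits v r +_) (out-middle v M p q N)) (x∙yz≈y∙xz (hits v r) (hits v p) _)

  into-middle : ∀ v M p q N → into v (M ++ (p , q) ∷ N) ≡ hits v q + into v (M ++ N)
  into-middle v [] p q N = refl
  into-middle v ((r , s) ∷ M) p q N = trans (cong (hits v s +_) (into-middle v M p q N)) (x∙yz≈y∙xz (hits v s) (hits v q) _)

  data Turn : V × V → V × V → Set where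
    keep : ∀ {p q} → Turn (p , q) (p , q)
    turn : ∀ {p q} → Turn (p , q) (q , p)

  Balanced : List (V × V) → Set
  Balanced M = ∀ v → out v M ≤ suc (into v M) × into v M ≤ suc (out v M)

  pointwise-++⁻ : ∀ {A B : Set} {R : A → B → Set} xs {ys zs} → Pointwise R (xs ++ ys) zs →
    ∃₂ λ us vs → zs ≡ us ++ vs × Pointwise R xs us × Pointwise R ys vs
  pointwise-++⁻ []       rs       = [] , _ , refl , [] , rs
  pointwise-++⁻ (x ∷ xs) (r ∷ rs) with pointwise-++⁻ xs rs
  ... | us , vs , refl , rs₁ , rs₂ = _ ∷ us , vs , refl , r ∷ rs₁ , rs₂

  hits-≢ : ∀ {v x} → x ≢ v → hits v x ≡ 0
  hits-≢ {v} {x} x≢v with x ≟ v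
  ... | yes eq = ⊥-elim (x≢v eq)
  ... | no _ = refl

  Meets : V → V × V → Set
  Meets y (p , q) = p ≡ y ⊎ q ≡ y

  avoid : ∀ {y s L p q} → Turn s (p , q) → ¬ Any (Meets y) (s ∷ L) → p ≢ y × q ≢ y
  avoid keep none = none ∘ here ∘ inj₁ , none ∘ here ∘ inj₂
  avoid turn none = none ∘ here ∘ inj₂ , none ∘ here ∘ inj₁

  untouched : ∀ {y L M} → Pointwise Turn L M → ¬ Any (Meets y) L → out y M ≡ 0 × into y M ≡ 0
  untouched [] none = refl , refl
  untouched {y} (_∷_ {y = p , q} t ts) none with untouched ts (none ∘ there)
  ... | o , i rewrite o | i | hits-≢ (proj₁ (avoid t none)) | hits-≢ (proj₂ (avoid t none)) = refl , refl

  -- Splitting off: the arcs at x y and y z are oriented along the orientation of x z.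
  pass-through : ∀ {x y z s} L₁ L₂ → s ≡ (y , z) ⊎ s ≡ (z , y) →
    Σ[ M ∈ List (V × V) ] (Pointwise Turn ((x , z) ∷ L₁ ++ L₂) M × Balanced M) →
    Σ[ M ∈ List (V × V) ] (Pointwise Turn ((x , y) ∷ L₁ ++ s ∷ L₂) M × Balanced M)
  pass-through {x} {y} {z} {s} L₁ L₂ s≡ (m ∷ M , t ∷ ts , balanced) with pointwise-++⁻ L₁ ts
  ... | M₁ , M₂ , refl , ts₁ , ts₂ = go t s≡ balanced
    where
    balance : ∀ N N′ → (∀ v → out v N′ ≡ hits v y + out v N) → (∀ v → into v N′ ≡ hits v y + into v N) →
      Balanced N → Balanced N′
    balance N N′ o i b v rewrite o v | i v =
        ≤-trans (+-monoʳ-≤ (hits v y) (proj₁ (b v))) (≤-reflexive (+-suc (hits v y) _))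
      , ≤-trans (+-monoʳ-≤ (hits v y) (proj₂ (b v))) (≤-reflexive (+-suc (hits v y) _))
    go : ∀ {m} → Turn (x , z) m → s ≡ (y , z) ⊎ s ≡ (z , y) → Balanced (m ∷ M₁ ++ M₂) →
      Σ[ M ∈ List (V × V) ] (Pointwise Turn ((x , y) ∷ L₁ ++ s ∷ L₂) M × Balanced M)
    go keep s≡ b = (x , y) ∷ M₁ ++ (y , z) ∷ M₂
      , keep ∷ Pointwise.++⁺ ts₁ (along s≡ ∷ ts₂)
      , balance ((x , z) ∷ M₁ ++ M₂) ((x , y) ∷ M₁ ++ (y , z) ∷ M₂)
          (λ v → trans (cong (hits v x +_) (out-middle v M₁ y z M₂)) (x∙yz≈y∙xz (hits v x) (hits v y) _))
          (λ v → cong (hits v y +_) (into-middle v M₁ y z M₂)) b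
      where
      along : s ≡ (y , z) ⊎ s ≡ (z , y) → Turn s (y , z)
      along (inj₁ refl) = keep
      along (inj₂ refl) = turn
    go turn s≡ b = (y , x) ∷ M₁ ++ (z , y) ∷ M₂
      , turn ∷ Pointwise.++⁺ ts₁ (against s≡ ∷ ts₂)
      , balance ((z , x) ∷ M₁ ++ M₂) ((y , x) ∷ M₁ ++ (z , y) ∷ M₂)
          (λ v → cong (hits v y +_) (out-middle v M₁ z y M₂))
          (λ v → trans (cong (hits v x +_) (into-middle v M₁ z y M₂)) (x∙yz≈y∙xz (hits v x) (hits v y) _)) b
      where
      against : s ≡ (y , z) ⊎ s ≡ (z , y) → Turn s (z , y)
      against (inj₁ refl) = turn
      against (inj₂ refl) = keep

  -- If no later arc meets `y`, the first arc is directed so as to lower the imbalance at `x`.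
  -- Otherwise it is merged with an arc at `y` into one that bypasses `y`. Merging can create loops
  -- and parallel arcs; a loop counts once in and once out and does no harm. Merged lists are not
  -- tails of `L`, hence the induction on a bound for the length.
  orient : ∀ n L → length L ≤ n → Σ[ M ∈ List (V × V) ] (Pointwise Turn L M × Balanced M)
  orient n [] _ = [] , [] , λ v → z≤n , z≤n
  orient (suc n) ((x , y) ∷ L) (s≤s L≤n) with any? (λ { (p , q) → (p ≟ y) ⊎-dec (q ≟ y) }) L
  ... | no none = attach (orient n L L≤n)
    where
    attach : Σ[ M ∈ List (V × V) ] (Pointwise Turn L M × Balanced M) →
      Σ[ M ∈ List (V × V) ] (Pointwise Turn ((x , y) ∷ L) M × Balanced M)
    attach (M , ts , b) with untouched ts none | ≤-total (out x M) (into x M)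
    ... | o , i | inj₁ out≤ = (x , y) ∷ M , keep ∷ ts , λ v → hit v , fresh v
      where
      hit : ∀ v → hits v x + out v M ≤ suc (hits v y + into v M)
      hit v with x ≟ v
      ... | yes refl = s≤s (≤-trans out≤ (m≤n+m _ (hits v y)))
      ... | no _ = ≤-trans (proj₁ (b v)) (s≤s (m≤n+m _ (hits v y)))
      fresh : ∀ v → hits v y + into v M ≤ suc (hits v x + out v M)
      fresh v with y ≟ v
      ... | yes refl rewrite i = s≤s z≤n
      ... | no _ = ≤-trans (proj₂ (b v)) (s≤s (m≤n+m _ (hits v x)))
    ... | o , i | inj₂ into≤ = (y , x) ∷ M , turn ∷ ts , λ v → fresh v , hit v
      where
      hit : ∀ v → hits v x + into v M ≤ suc (hits v y + out v M)
      hit v with x ≟ v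
      ... | yes refl = s≤s (≤-trans into≤ (m≤n+m _ (hits v y)))
      ... | no _ = ≤-trans (proj₂ (b v)) (s≤s (m≤n+m _ (hits v y)))
      fresh : ∀ v → hits v y + out v M ≤ suc (hits v x + into v M)
      fresh v with y ≟ v
      ... | yes refl rewrite o = s≤s z≤n
      ... | no _ = ≤-trans (proj₁ (b v)) (s≤s (m≤n+m _ (hits v x)))
  ... | yes found with find found
  ...   | (p , q) , s∈ , meets with ∈-∃++ s∈
  ...     | L₁ , L₂ , refl = continue meets
    where
    shorter : ∀ z → length ((x , z) ∷ L₁ ++ L₂) ≤ n
    shorter z = ≤-trans (≤-reflexive (sym (trans (length-++ L₁)
      (trans (+-suc (length L₁) (length L₂)) (cong suc (sym (length-++ L₁))))))) L≤n
    continue : p ≡ y ⊎ q ≡ y → Σ[ M ∈ List (V × V) ] (Pointwise Turn ((x , y) ∷ L₁ ++ (p , q) ∷ L₂) M × Balanced M)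
    continue (inj₁ refl) = pass-through L₁ L₂ (inj₁ refl) (orient n ((x , q) ∷ L₁ ++ L₂) (shorter q))
    continue (inj₂ refl) = pass-through L₁ L₂ (inj₂ refl) (orient n ((x , p) ∷ L₁ ++ L₂) (shorter p))

-- Incidence structures and weak location in them.

record Incidence : Set₁ where
  field
    {V A}   : Set
    _≟ᵥ_    : DecidableEquality V
    _≟_     : DecidableEquality A
    _∈ᵥ_    : V → A → Set
    _∈ᵥ?_   : ∀ v e → Dec (v ∈ᵥ e)
    shape   : ∀ e → (∀ {p} → ¬ p ∈ᵥ e) ⊎ ∃₂ (Ends _∈ᵥ_ e)
    simple  : ∀ {e f p q} → p ≢ q → p ∈ᵥ e → q ∈ᵥ e → p ∈ᵥ f → q ∈ᵥ f → e ≡ f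
    null    : A
    null-empty : ∀ {p} → ¬ p ∈ᵥ null
    vertices : List V
    vertices-unique : Unique vertices
    ∈-vertices : ∀ v → v ∈ vertices

-- Domination is the requirement that an edge be located against the item null,
-- which has no ends.
module WeakLocation (I : Incidence) where

  open Incidence I
  open Ends
  open import Data.List.Membership.DecPropositional _≟_ using (_∈?_; _∉?_)

  Ends′ : A → V → V → Set
  Ends′ = Ends _∈ᵥ_

  flip-ends : ∀ {e p q} → Ends′ e p q → Ends′ e q p
  flip-ends (mkEnds l r d o) = mkEnds r l (≢-sym d) (Sum.swap ∘ o)

  ends : ∀ {e p} → p ∈ᵥ e → Σ[ q ∈ V ] Ends′ e p q
  ends {e} {p} p∈e with shape e
  ... | inj₁ empty = ⊥-elim (empty p∈e)
  ... | inj₂ (r , s , E) with only E p∈e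
  ...   | inj₁ refl = s , E
  ...   | inj₂ refl = r , flip-ends E

  _~_ : A → A → Set
  d ~ e = Σ[ r ∈ V ] (r ∈ᵥ d × r ∈ᵥ e)

  ~-sym : ∀ {d e} → d ~ e → e ~ d
  ~-sym (r , rd , re) = r , re , rd

  _≁_ : A → A → Set
  d ≁ e = ¬ (d ~ e)

  _~?_ : ∀ d e → Dec (d ~ e)
  d ~? e with shape e
  ... | inj₁ empty = no λ { (_ , _ , re) → empty re }
  ... | inj₂ (p , q , E) =
    map′ (λ { (inj₁ pd) → p , pd , left E ; (inj₂ qd) → q , qd , right E })
         (λ { (r , rd , re) → Sum.map (λ { refl → rd }) (λ { refl → rd }) (only E re) })
         ((p ∈ᵥ? d) ⊎-dec (q ∈ᵥ? d))

  ~-ends : ∀ {d e p q} → Ends′ e p q → d ~ e → p ∈ᵥ d ⊎ q ∈ᵥ d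
  ~-ends E (r , rd , re) = Sum.map (λ { refl → rd }) (λ { refl → rd }) (only E re)

  Same : List A → A → A → Set
  Same D e f = ∀ {d} → d ∈ D → (d ~ e → d ~ f) × (d ~ f → d ~ e)

  same-sym : ∀ {D e f} → Same D e f → Same D f e
  same-sym s d∈ = swap (s d∈)

  same-trans : ∀ {D e f g} → Same D e f → Same D f g → Same D e g
  same-trans s t d∈ = proj₁ (t d∈) ∘ proj₁ (s d∈) , proj₂ (s d∈) ∘ proj₂ (t d∈)

  -- Together with its mirror image this says that `e` and `f` have the same neighbours apart from
  -- each other, which is closed twinship if they touch and open twinship if not. One formula thus
  -- serves for both kinds of twins.
  Good : List A → List A → Set
  Good E D = ∀ {e f} → e ∈ null ∷ E → f ∈ null ∷ E → e ∉ D → f ∉ D → Same D e f →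
    ∀ {x} → x ∈ E → x ≢ e → x ≢ f → x ~ e → x ~ f

  record Bad (E D : List A) : Set where
    constructor mkBad
    field
      {e f x} : A
      e∈  : e ∈ null ∷ E
      f∈  : f ∈ null ∷ E
      e∉  : e ∉ D
      f∉  : f ∉ D
      same : Same D e f
      x∈  : x ∈ E
      x≢e : x ≢ e
      x≢f : x ≢ f
      x~e : x ~ e
      x≁f : x ≁ f

  good-or-bad : ∀ E D → Good E D ⊎ Bad E D
  good-or-bad E D with any? (λ e → any? (λ f → any? (λ x → clash? e f x) E) (null ∷ E)) (null ∷ E)
    where
    clash? : ∀ e f x → Dec (e ∉ D × f ∉ D × All (λ d → (d ~ e → d ~ f) × (d ~ f → d ~ e)) D
                              × x ≢ e × x ≢ f × x ~ e × x ≁ f)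
    clash? e f x = (e ∉? D) ×-dec (f ∉? D)
      ×-dec All.all? (λ d → ((d ~? e) →-dec (d ~? f)) ×-dec ((d ~? f) →-dec (d ~? e))) D
      ×-dec ¬? (x ≟ e) ×-dec ¬? (x ≟ f) ×-dec (x ~? e) ×-dec ¬? (x ~? f)
  ... | yes found with find found
  ...   | e , e∈ , found′ with find found′
  ...     | f , f∈ , found″ with find found″
  ...       | x , x∈ , e∉ , f∉ , same , x≢e , x≢f , x~e , x≁f =
    inj₂ (mkBad e∈ f∈ e∉ f∉ (All.lookup same) x∈ x≢e x≢f x~e x≁f)
  good-or-bad E D | no none = inj₁ good
    where
    good : Good E D
    good {e} {f} e∈ f∈ e∉ f∉ same {x} x∈ x≢e x≢f x~e with x ~? f
    ... | yes x~f = x~f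
    ... | no x≁f = ⊥-elim (none (lose e∈ (lose f∈ (lose x∈
            (e∉ , f∉ , All.tabulate same , x≢e , x≢f , x~e , x≁f)))))

  record Solution (E : List A) : Set where
    constructor mkSolution
    field
      D      : List A
      D⊆E    : ∀ {d} → d ∈ D → d ∈ E
      D-unique : Unique D
      small  : 2 * length D ≤ length E
      good   : Good E D

  remove : A → List A → List A
  remove x = filter (λ y → ¬? (y ≟ x))

  _∖_ : List A → List A → List A
  E ∖ []      = E
  E ∖ (x ∷ H) = remove x (E ∖ H)

  ∈-∖⁻ : ∀ {E} H {y} → y ∈ E ∖ H → y ∈ E × y ∉ H
  ∈-∖⁻ [] y∈ = y∈ , λ ()
  ∈-∖⁻ (x ∷ H) y∈ with ∈-filter⁻ (λ y → ¬? (y ≟ x)) y∈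
  ... | y∈′ , y≢x with ∈-∖⁻ H y∈′
  ...   | y∈E , y∉H = y∈E , λ { (here eq) → y≢x eq ; (there y∈H) → y∉H y∈H }

  ∈-∖⁺ : ∀ {E} H {y} → y ∈ E → y ∉ H → y ∈ E ∖ H
  ∈-∖⁺ [] y∈ y∉ = y∈
  ∈-∖⁺ (x ∷ H) y∈ y∉ = ∈-filter⁺ (λ y → ¬? (y ≟ x)) (∈-∖⁺ H y∈ (y∉ ∘ there)) (y∉ ∘ here)

  ∖-unique : ∀ {E} H → Unique E → Unique (E ∖ H)
  ∖-unique [] u = u
  ∖-unique (x ∷ H) u = Unique.filter⁺ (λ y → ¬? (y ≟ x)) (∖-unique H u)

  length-remove : ∀ {x E} → Unique E → x ∈ E → length E ≡ suc (length (remove x E))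
  length-remove {x} {x ∷ E} (x∉ ∷ u) (here refl) = cong (suc ∘ length)
    (sym (trans (filter-reject (λ y → ¬? (y ≟ x)) {x} {E} (λ x≢x → x≢x refl))
                (filter-all (λ y → ¬? (y ≟ x)) (All.map ≢-sym x∉))))
  length-remove {x} {y ∷ E} (y∉ ∷ u) (there x∈)
    rewrite filter-accept (λ y → ¬? (y ≟ x)) {y} {E} (All.lookup y∉ x∈) = cong suc (length-remove u x∈)

  length-∖ : ∀ {E} H → Unique E → Unique H → (∀ {x} → x ∈ H → x ∈ E) →
    length E ≡ length H + length (E ∖ H)
  length-∖ [] uE uH H⊆E = refl
  length-∖ {E} (x ∷ H) uE (x∉ ∷ uH) H⊆E =
    trans (length-∖ H uE uH (H⊆E ∘ there))
      (trans (cong (length H +_) (length-remove (∖-unique H uE)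
               (∈-∖⁺ H (H⊆E (here refl)) (λ x∈H → All.lookup x∉ x∈H refl))))
             (+-suc (length H) _))

  Proper : List A → Set
  Proper E = ∀ {e} → e ∈ E → ∃₂ (Ends′ e)

  record Instance : Set where
    field
      E        : List A
      E-unique : Unique E
      proper   : Proper E
      rec      : ∀ E′ → Unique E′ → Proper E′ → length E′ < length E → Solution E′

  -- The inductive step: deleting edges and restoring them.

  module Reduction (ι : Instance) where

    open Instance ι

    null∉E : null ∉ E
    null∉E null∈ with proper null∈
    ... | _ , _ , En = null-empty (left En)

    Edge′ : V → V → Set
    Edge′ p q = Σ[ e ∈ A ] (e ∈ E × p ∈ᵥ e × q ∈ᵥ e)

    edge? : ∀ p q → Dec (Edge′ p q)
    edge? p q = map′ find (λ { (e , e∈ , pq) → lose e∈ pq }) (any? (λ e → (p ∈ᵥ? e) ×-dec (q ∈ᵥ? e)) E)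

    record Rest (H : List A) : Set where
      field
        E′       : List A
        split    : ∀ {x} → x ∈ E → x ∈ H ⊎ x ∈ E′
        E′⊆E     : ∀ {x} → x ∈ E′ → x ∈ E
        disjoint : ∀ {x} → x ∈ E′ → x ∉ H
        D′       : List A
        D′⊆E′    : ∀ {d} → d ∈ D′ → d ∈ E′
        D′-unique : Unique D′
        bound    : length H + 2 * length D′ ≤ length E
        good′    : Good E′ D′

      null∷⊆ : ∀ {e} → e ∈ null ∷ E → e ∉ H → e ∈ null ∷ E′
      null∷⊆ (here eq) _ = here eq
      null∷⊆ (there e∈) e∉H with split e∈
      ... | inj₁ e∈H = ⊥-elim (e∉H e∈H)
      ... | inj₂ e∈′ = there e∈′

      same→twin : ∀ {e f} → e ∈ null ∷ E′ → f ∈ null ∷ E′ → e ∉ D′ → f ∉ D′ → Same D′ e f →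
        ∀ {x} → x ∈ E′ → x ≢ e → x ≢ f → (x ~ e → x ~ f) × (x ~ f → x ~ e)
      same→twin e∈ f∈ e∉ f∉ s x∈ x≢e x≢f =
        good′ e∈ f∈ e∉ f∉ s x∈ x≢e x≢f , good′ f∈ e∈ f∉ e∉ (same-sym s) x∈ x≢f x≢e

      -- Such an `f` has the trace of `null`, and `null` touches nothing.
      undominated→isolated : ∀ {f} → f ∈ E′ → f ∉ D′ → (∀ {d} → d ∈ D′ → d ≁ f) →
        ∀ {x} → x ∈ E′ → x ≢ f → x ≁ f
      undominated→isolated f∈ f∉ undominated x∈ x≢f x~f =
        empty (proj₁ (same→twin (there f∈) (here refl) f∉ (null∉E ∘ E′⊆E ∘ D′⊆E′)
          (λ d∈ → (λ d~f → ⊥-elim (undominated d∈ d~f)) , λ d~null → ⊥-elim (empty d~null))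
          x∈ x≢f (λ { refl → null∉E (E′⊆E x∈) })) x~f)
        where
        empty : ∀ {d} → d ≁ null
        empty (_ , _ , r∈null) = null-empty r∈null

    delete : ∀ H → Unique H → (∀ {x} → x ∈ H → x ∈ E) → 1 ≤ length H → Rest H
    delete H uH H⊆E nonempty = record
      { E′ = E ∖ H
      ; split = λ {x} x∈ → case x ∈? H of λ { (yes x∈H) → inj₁ x∈H ; (no x∉H) → inj₂ (∈-∖⁺ H x∈ x∉H) }
      ; E′⊆E = proj₁ ∘ ∈-∖⁻ H
      ; disjoint = proj₂ ∘ ∈-∖⁻ H
      ; D′ = D ; D′⊆E′ = D⊆E ; D′-unique = D-unique ; good′ = good
      ; bound = ≤-trans (+-monoʳ-≤ (length H) small) (≤-reflexive (sym len))
      }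
      where
      len = length-∖ H E-unique uH H⊆E
      open Solution (rec (E ∖ H) (∖-unique H E-unique) (proper ∘ proj₁ ∘ ∈-∖⁻ H)
                         (≤-trans (+-monoˡ-≤ _ nonempty) (≤-reflexive (sym len))))

    extend : ∀ {H} (R : Rest H) S → Unique S → (∀ {x} → x ∈ S → x ∈ H) → (∀ {x} → x ∈ H → x ∈ E) →
      2 * length S ≤ length H → Good E (S ++ Rest.D′ R) → Solution E
    extend {H} R S uS S⊆H H⊆E small good = mkSolution (S ++ D′)
      (λ d∈ → case ∈-++⁻ S d∈ of λ { (inj₁ d∈S) → H⊆E (S⊆H d∈S) ; (inj₂ d∈D) → E′⊆E (D′⊆E′ d∈D) })
      (Unique.++⁺ uS D′-unique (λ { (d∈S , d∈D) → disjoint (D′⊆E′ d∈D) (S⊆H d∈S) }))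
      (≤-trans (≤-reflexive (trans (cong (2 *_) (length-++ S)) (*-distribˡ-+ 2 (length S) (length D′))))
        (≤-trans (+-monoˡ-≤ _ small) bound))
      good
      where open Rest R

    ends≢ : ∀ {e f p q r} → Ends′ e p q → r ∈ᵥ f → r ≢ p → r ≢ q → e ≢ f
    ends≢ Ee r∈f r≢p r≢q refl with only Ee r∈f
    ... | inj₁ eq = r≢p eq
    ... | inj₂ eq = r≢q eq

    ++-∉ : ∀ {S D : List A} {e} → e ∉ S ++ D → e ∉ S × e ∉ D
    ++-∉ {S} e∉ = e∉ ∘ ∈-++⁺ˡ , e∉ ∘ ∈-++⁺ʳ S

    same-++ : ∀ S {D e f} → Same (S ++ D) e f → Same S e f × Same D e f
    same-++ S s = (λ d∈ → s (∈-++⁺ˡ d∈)) , (λ d∈ → s (∈-++⁺ʳ S d∈))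

    -- Edge sets that contain a K₄.

    record Tetrahedron : Set where
      field
        {p q r s}           : V
        {pq pr ps qr qs rs} : A
        Epq : Ends′ pq p q
        Epr : Ends′ pr p r
        Eps : Ends′ ps p s
        Eqr : Ends′ qr q r
        Eqs : Ends′ qs q s
        Ers : Ends′ rs r s
        star∈  : All (_∈ E) (pq ∷ pr ∷ ps ∷ [])
        sides∈ : All (_∈ E) (qr ∷ qs ∷ rs ∷ [])

    -- The star at p is chosen. An edge qr of the opposite triangle is then the only item
    -- touching exactly pq and pr among the three.
    module K₄ (T : Tetrahedron) where

      open Tetrahedron T

      star sides : List A
      star  = pq ∷ pr ∷ ps ∷ []
      sides = qr ∷ qs ∷ rs ∷ []

      p≢q = distinct Epq
      p≢r = distinct Epr
      p≢s = distinct Eps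
      q≢r = distinct Eqr
      q≢s = distinct Eqs
      r≢s = distinct Ers

      pq≢pr = ends≢ Epq (right Epr) (≢-sym p≢r) (≢-sym q≢r)
      pq≢ps = ends≢ Epq (right Eps) (≢-sym p≢s) (≢-sym q≢s)
      pr≢ps = ends≢ Epr (right Eps) (≢-sym p≢s) (≢-sym r≢s)

      star-unique : Unique star
      star-unique = (pq≢pr ∷ pq≢ps ∷ []) ∷ (pr≢ps ∷ []) ∷ [] ∷ []

      all-unique : Unique (star ++ sides)
      all-unique =
           (pq≢pr ∷ pq≢ps ∷ ends≢ Epq (right Eqr) (≢-sym p≢r) (≢-sym q≢r)
              ∷ ends≢ Epq (right Eqs) (≢-sym p≢s) (≢-sym q≢s)
              ∷ ends≢ Epq (left Ers) (≢-sym p≢r) (≢-sym q≢r) ∷ [])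
         ∷ (pr≢ps ∷ ends≢ Epr (left Eqr) (≢-sym p≢q) q≢r ∷ ends≢ Epr (left Eqs) (≢-sym p≢q) q≢r
              ∷ ends≢ Epr (right Ers) (≢-sym p≢s) (≢-sym r≢s) ∷ [])
         ∷ (ends≢ Eps (left Eqr) (≢-sym p≢q) q≢s ∷ ends≢ Eps (left Eqs) (≢-sym p≢q) q≢s
              ∷ ends≢ Eps (left Ers) (≢-sym p≢r) r≢s ∷ [])
         ∷ (ends≢ Eqr (right Eqs) (≢-sym q≢s) (≢-sym r≢s)
              ∷ ends≢ Eqr (right Ers) (≢-sym q≢s) (≢-sym r≢s) ∷ [])
         ∷ (ends≢ Eqs (left Ers) (≢-sym q≢r) r≢s ∷ [])
         ∷ [] ∷ []

      all∈ : ∀ {x} → x ∈ star ++ sides → x ∈ E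
      all∈ = Sum.[ All.lookup star∈ , All.lookup sides∈ ]′ ∘ ∈-++⁻ star

      record Spoke (a : V) : Set where
        constructor spoke
        field
          {d}  : A
          Ed   : Ends′ d p a
          d∈   : d ∈ star

      pattern 1st = here refl
      pattern 2nd = there (here refl)
      pattern 3rd = there (there (here refl))

      to-q = spoke Epq 1st
      to-r = spoke Epr 2nd
      to-s = spoke Eps 3rd

      open Spoke

      opposite : ∀ {a b c k f} → Ends′ k a b → Spoke a → Spoke b → Spoke c → c ≢ a → c ≢ b →
        Same star k f → k ≡ f
      opposite {a} {b} {c} {k} {f} Ek A B C c≢a c≢b same =
        simple (distinct Ek) (left Ek) (right Ek) (reach A (left Ek)) (reach B (right Ek))
        where
        p∉f : ¬ p ∈ᵥ f
        p∉f p∈f = case ~-ends Ek (proj₂ (same (d∈ C)) (p , left (Ed C) , p∈f)) of λ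
          { (inj₁ a∈) → case only (Ed C) a∈ of λ { (inj₁ eq) → distinct (Ed A) (sym eq) ; (inj₂ eq) → c≢a (sym eq) }
          ; (inj₂ b∈) → case only (Ed C) b∈ of λ { (inj₁ eq) → distinct (Ed B) (sym eq) ; (inj₂ eq) → c≢b (sym eq) } }
        reach : ∀ {z} → Spoke z → z ∈ᵥ k → z ∈ᵥ f
        reach Z z∈k = case ~-ends (Ed Z) (~-sym (proj₁ (same (d∈ Z)) (_ , right (Ed Z) , z∈k))) of λ
          { (inj₁ p∈f) → ⊥-elim (p∉f p∈f) ; (inj₂ z∈f) → z∈f }

      located : ∀ {k f} → k ∈ sides → Same star k f → k ≡ f
      located 1st = opposite Eqr to-q to-r to-s (≢-sym q≢s) (≢-sym r≢s)
      located 2nd = opposite Eqs to-q to-s to-r (≢-sym q≢r) r≢s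
      located 3rd = opposite Ers to-r to-s to-q q≢r q≢s

      -- The spoke at `a` touches `e`, hence `f`. If it met `f` in `p`, then the spoke at `b` would
      -- touch `f`, hence `e`, and `e` would be a spoke or the side `x`. So `a` lies on `f`.
      reach : ∀ {a b x e f} → Ends′ x a b → Spoke a → Spoke b → e ∉ star → x ≢ e → Same star e f →
        a ∈ᵥ e → x ~ f
      reach Ex A B e∉ x≢e same a∈e =
        case ~-ends (Ed A) (~-sym (proj₁ (same (d∈ A)) (_ , right (Ed A) , a∈e))) of λ
          { (inj₂ a∈f) → _ , left Ex , a∈f
          ; (inj₁ p∈f) → case ~-ends (Ed B) (~-sym (proj₂ (same (d∈ B)) (p , left (Ed B) , p∈f))) of λ
              { (inj₁ p∈e) → ⊥-elim (e∉ (subst (_∈ star)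
                  (simple (distinct (Ed A)) (left (Ed A)) (right (Ed A)) p∈e a∈e) (d∈ A)))
              ; (inj₂ b∈e) → ⊥-elim (x≢e (simple (distinct Ex) (left Ex) (right Ex) a∈e b∈e)) } }

      cover : ∀ {a b x e f} → Ends′ x a b → Spoke a → Spoke b → e ∉ star → x ≢ e → Same star e f →
        x ~ e → x ~ f
      cover Ex A B e∉ x≢e same x~e = case ~-ends Ex (~-sym x~e) of λ
        { (inj₁ a∈e) → reach Ex A B e∉ x≢e same a∈e
        ; (inj₂ b∈e) → reach (flip-ends Ex) B A e∉ x≢e same b∈e }

      cover-sides : ∀ {x e f} → x ∈ sides → e ∉ star → x ≢ e → Same star e f → x ~ e → x ~ f
      cover-sides 1st = cover Eqr to-q to-r
      cover-sides 2nd = cover Eqs to-q to-s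
      cover-sides 3rd = cover Ers to-r to-s

      module _ (R : Rest (star ++ sides)) where

        open Rest R

        -- A side is determined by its trace on the star. For two edges outside the K₄, the goodness
        -- of `D′` deals with surviving `x`, the trace with spokes, and `cover-sides` with sides.
        good-star : Good E (star ++ D′)
        good-star {e} {f} e∈ f∈ e∉ f∉ same {x} x∈ x≢e x≢f x~e with e ∈? sides | f ∈? sides
        ... | yes e∈s | _ = subst (x ~_) (located e∈s (proj₁ (same-++ star same))) x~e
        ... | no _ | yes f∈s = subst (x ~_) (sym (located f∈s (same-sym (proj₁ (same-++ star same))))) x~e
        ... | no e∉s | no f∉s with split x∈
        ...   | inj₂ x∈′ = proj₁ (same→twin (null∷⊆ e∈ (outside e∉ e∉s)) (null∷⊆ f∈ (outside f∉ f∉s))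
                             (proj₂ (++-∉ e∉)) (proj₂ (++-∉ f∉)) (proj₂ (same-++ star same)) x∈′ x≢e x≢f) x~e
          where
          outside : ∀ {e} → e ∉ star ++ D′ → e ∉ sides → e ∉ star ++ sides
          outside e∉ e∉s e∈H = Sum.[ e∉ ∘ ∈-++⁺ˡ , e∉s ]′ (∈-++⁻ star e∈H)
        ...   | inj₁ x∈H with ∈-++⁻ star x∈H
        ...     | inj₁ x∈star = proj₁ (same (∈-++⁺ˡ x∈star)) x~e
        ...     | inj₂ x∈sides = cover-sides x∈sides (proj₁ (++-∉ e∉)) x≢e (proj₁ (same-++ star same)) x~e

      solution : Solution E
      solution = extend R star star-unique ∈-++⁺ˡ all∈ ≤-refl (good-star R)
        where
        R : Rest (star ++ sides)
        R = delete (star ++ sides) all-unique all∈ (s≤s z≤n)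

    -- Deleting two edges and choosing one of them.

    record Pruned (g h : A) : Set where
      field
        {H}   : List A
        rest  : Rest H
        -- `H` is known only through its members, so that `flip-pruned` exchanges `g` and `h` over
        -- the very same `D′`. The failures of both choices can then be compared.
        cases : ∀ {x} → x ∈ H → x ≡ g ⊎ x ≡ h
        g∈H   : g ∈ H
        h∈H   : h ∈ H
        H⊆E   : ∀ {x} → x ∈ H → x ∈ E
        two   : 2 ≤ length H

      open Rest rest public

      split₂ : ∀ {x} → x ∈ E → x ≡ g ⊎ x ≡ h ⊎ x ∈ E′
      split₂ x∈ = case split x∈ of λ
        { (inj₁ x∈H) → Sum.map₂ inj₁ (cases x∈H) ; (inj₂ x∈′) → inj₂ (inj₂ x∈′) }

      ≢g : ∀ {x} → x ∈ E′ → x ≢ g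
      ≢g x∈ refl = disjoint x∈ g∈H

      ≢h : ∀ {x} → x ∈ E′ → x ≢ h
      ≢h x∈ refl = disjoint x∈ h∈H

      null∷⊆₂ : ∀ {e} → e ∈ null ∷ E → e ≢ g → e ≢ h → e ∈ null ∷ E′
      null∷⊆₂ e∈ e≢g e≢h = null∷⊆ e∈ (Sum.[ e≢g , e≢h ]′ ∘ cases)

      add-h : Good E (h ∷ D′) → Solution E
      add-h = extend rest (h ∷ []) ([] ∷ []) (λ { (here refl) → h∈H }) H⊆E two

    flip-pruned : ∀ {g h} → Pruned g h → Pruned h g
    flip-pruned P = record
      { rest = rest ; cases = Sum.swap ∘ cases ; g∈H = h∈H ; h∈H = g∈H ; H⊆E = H⊆E ; two = two }
      where open Pruned P

    prune : ∀ {g h} → g ∈ E → h ∈ E → g ≢ h → Pruned g h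
    prune {g} {h} g∈ h∈ g≢h = record
      { rest = delete (g ∷ h ∷ []) ((g≢h ∷ []) ∷ [] ∷ []) H⊆E (s≤s z≤n)
      ; cases = λ { (here eq) → inj₁ eq ; (there (here eq)) → inj₂ eq }
      ; g∈H = here refl ; h∈H = there (here refl) ; H⊆E = H⊆E ; two = ≤-refl }
      where
      H⊆E : ∀ {x} → x ∈ g ∷ h ∷ [] → x ∈ E
      H⊆E (here refl) = g∈
      H⊆E (there (here refl)) = h∈

    Separates : A → A → A → Set
    Separates x e f = (x ~ e × x ≁ f) ⊎ (x ~ f × x ≁ e)

    module _ {g h : A} (P : Pruned g h) where

      open Pruned P

      -- If h is chosen and g is not, then a bad pair contains g, or it is a new pair: one of
      -- twins that are told apart only by g.
      record Collision : Set where
        field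
          {f x} : A
          f∈    : f ∈ E′
          f∉    : f ∉ D′
          h~f   : h ~ f
          same  : Same D′ g f
          x∈    : x ∈ E
          x≢g   : x ≢ g
          x≢f   : x ≢ f
          apart : Separates x g f

      record NewPair : Set where
        field
          {e f} : A
          e∈    : e ∈ E′
          f∈    : f ∈ null ∷ E′
          e∉    : e ∉ D′
          f∉    : f ∉ D′
          same  : Same D′ e f
          g~e   : g ~ e
          g≁f   : g ≁ f
          h~    : (h ~ e → h ~ f) × (h ~ f → h ~ e)

        twin : ∀ {x} → x ∈ E′ → x ≢ e → x ≢ f → (x ~ e → x ~ f) × (x ~ f → x ~ e)
        twin = same→twin (there e∈) f∈ e∉ f∉ same

      ~→∈ : ∀ {d e} → d ~ e → e ∈ null ∷ E′ → e ∈ E′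
      ~→∈ (_ , _ , r∈) (here refl) = ⊥-elim (null-empty r∈)
      ~→∈ _ (there e∈) = e∈

      -- If `g` is outside the bad pair, then `x` did not survive the deletion, since `D′` is good
      -- for the surviving edges; nor is `x` the chosen `h`, on which the traces agree. So `x` is
      -- `g`.
      failure : h ~ g → Bad E (h ∷ D′) → Collision ⊎ NewPair
      failure h~g (mkBad {e} {f} {x} e∈ f∈ e∉ f∉ same x∈ x≢e x≢f x~e x≁f) with e ≟ g | f ≟ g
      ... | yes refl | yes refl = ⊥-elim (x≁f x~e)
      ... | yes refl | no f≢g = inj₁ record
        { f∈ = ~→∈ h~f (null∷⊆₂ f∈ f≢g (f∉ ∘ here)) ; f∉ = f∉ ∘ there ; h~f = h~f ; same = same ∘ there
        ; x∈ = x∈ ; x≢g = x≢e ; x≢f = x≢f ; apart = inj₁ (x~e , x≁f) }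
        where h~f = proj₁ (same (here refl)) h~g
      ... | no e≢g | yes refl = inj₁ record
        { f∈ = ~→∈ h~e (null∷⊆₂ e∈ e≢g (e∉ ∘ here)) ; f∉ = e∉ ∘ there ; h~f = h~e ; same = same-sym same ∘ there
        ; x∈ = x∈ ; x≢g = x≢f ; x≢f = x≢e ; apart = inj₂ (x~e , x≁f) }
        where h~e = proj₂ (same (here refl)) h~g
      ... | no e≢g | no f≢g with split₂ x∈
      ...   | inj₁ refl = inj₂ record
        { e∈ = ~→∈ x~e (null∷⊆₂ e∈ e≢g (e∉ ∘ here)) ; f∈ = null∷⊆₂ f∈ f≢g (f∉ ∘ here)
        ; e∉ = e∉ ∘ there ; f∉ = f∉ ∘ there ; same = same ∘ there
        ; g~e = x~e ; g≁f = x≁f ; h~ = same (here refl) }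
      ...   | inj₂ (inj₁ refl) = ⊥-elim (x≁f (proj₁ (same (here refl)) x~e))
      ...   | inj₂ (inj₂ x∈′) = ⊥-elim (x≁f (proj₁ (same→twin
                (null∷⊆₂ e∈ e≢g (e∉ ∘ here)) (null∷⊆₂ f∈ f≢g (f∉ ∘ here)) (e∉ ∘ there) (f∉ ∘ there)
                (same ∘ there) x∈′ x≢e x≢f) x~e))

      choose-h : h ~ g → (Collision → Solution E) → (NewPair → Solution E) → Solution E
      choose-h h~g on-collision on-new-pair =
        Sum.[ add-h , Sum.[ on-collision , on-new-pair ]′ ∘ failure h~g ]′ (good-or-bad E (h ∷ D′))

    -- Vertices of degree 2.

    record Deg2 (v a b : V) : Set where
      field
        {g h} : A
        g∈   : g ∈ E
        h∈   : h ∈ E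
        Eg   : Ends′ g v a
        Eh   : Ends′ h v b
        a≢b  : a ≢ b
        at-v : ∀ {x} → x ∈ E → v ∈ᵥ x → x ≡ g ⊎ x ≡ h

      h~g : h ~ g
      h~g = v , left Eh , left Eg

      g≢h : g ≢ h
      g≢h = ends≢ Eg (right Eh) (≢-sym (distinct Eh)) (≢-sym a≢b)

    Pruned₂ : ∀ {v a b} → Deg2 v a b → Set
    Pruned₂ Δ = Pruned (Deg2.g Δ) (Deg2.h Δ)

    flip₂ : ∀ {v a b} → Deg2 v a b → Deg2 v b a
    flip₂ Δ = record { g∈ = h∈ ; h∈ = g∈ ; Eg = Eh ; Eh = Eg ; a≢b = ≢-sym a≢b
                     ; at-v = λ x∈ v∈ → Sum.swap (at-v x∈ v∈) }
      where open Deg2 Δ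

    module AtDeg2 {v a b} (Δ : Deg2 v a b) (P : Pruned₂ Δ) where

      open Deg2 Δ
      open Pruned P

      v∉ : ∀ {x} → x ∈ E′ → ¬ v ∈ᵥ x
      v∉ x∈ v∈x = Sum.[ ≢g x∈ , ≢h x∈ ]′ (at-v (E′⊆E x∈) v∈x)

      at-a : ∀ {x} → x ∈ E′ → x ~ g → a ∈ᵥ x
      at-a x∈ x~g = Sum.[ ⊥-elim ∘ v∉ x∈ , id ]′ (~-ends Eg x~g)

      at-b : ∀ {x} → x ∈ E′ → x ~ h → b ∈ᵥ x
      at-b x∈ x~h = Sum.[ ⊥-elim ∘ v∉ x∈ , id ]′ (~-ends Eh x~h)

      touch-a : ∀ {x} → a ∈ᵥ x → x ~ g
      touch-a a∈x = a , a∈x , right Eg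

      touch-b : ∀ {x} → b ∈ᵥ x → x ~ h
      touch-b b∈x = b , b∈x , right Eh

    -- As `a` is a leaf, no surviving edge touches `g`, which excludes new pairs. An edge `f` that
    -- collides with `g` is undominated by `D′`, hence isolated in `E′`, and nothing is left to
    -- separate it from `g`.
    leg : ∀ {v a b} (Δ : Deg2 v a b) → (∀ {x} → x ∈ E → a ∈ᵥ x → x ≡ Deg2.g Δ) → Solution E
    leg {v} {a} {b} Δ pendant = choose-h P h~g collision new-pair
      where
      open Deg2 Δ
      P = prune g∈ h∈ g≢h
      open Pruned P
      open AtDeg2 Δ P
      a∉ : ∀ {x} → x ∈ E′ → x ≁ g
      a∉ x∈ x~g = ≢g x∈ (pendant (E′⊆E x∈) (at-a x∈ x~g))
      new-pair : NewPair P → Solution E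
      new-pair N = ⊥-elim (a∉ (NewPair.e∈ N) (~-sym (NewPair.g~e N)))
      collision : Collision P → Solution E
      collision C = ⊥-elim (contra (split₂ x∈) apart)
        where
        open Collision C
        isolated : ∀ {y} → y ∈ E′ → y ≢ f → y ≁ f
        isolated = undominated→isolated f∈ f∉ (λ d∈ d~f → a∉ (D′⊆E′ d∈) (proj₂ (same d∈) d~f))
        contra : x ≡ g ⊎ x ≡ h ⊎ x ∈ E′ → Separates x g f → ⊥
        contra (inj₁ eq) _ = x≢g eq
        contra (inj₂ (inj₁ refl)) (inj₁ (_ , h≁f)) = h≁f h~f
        contra (inj₂ (inj₁ refl)) (inj₂ (_ , h≁g)) = h≁g h~g
        contra (inj₂ (inj₂ x∈′)) (inj₁ (x~g , _)) = a∉ x∈′ x~g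
        contra (inj₂ (inj₂ x∈′)) (inj₂ (x~f , _)) = isolated x∈′ x≢f x~f

    -- A vertex of degree 2 in a triangle.

    module Triangle {v a b m} (Δ : Deg2 v a b) (P : Pruned₂ Δ)
      (Em : Ends′ m a b) (m∈ : m ∈ Pruned.E′ P) where

      open Deg2 Δ
      open Pruned P

      open AtDeg2 Δ P

      is-m : ∀ {x} → a ∈ᵥ x → b ∈ᵥ x → x ≡ m
      is-m a∈x b∈x = simple a≢b a∈x b∈x (left Em) (right Em)

      -- The ways in which choosing `h` can fail: `g` collides with `m` (`level`), `g` collides with
      -- another edge at `b` (`swing`), or `g` separates `m` from a former twin `f` (`fresh`). Each
      -- constructor keeps only what the comparison with the mirrored obstacle uses.
      data Obstacle : Set where
        level : (∀ {d} → d ∈ D′ → ¬ b ∈ᵥ d) → m ∉ D′ →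
          ∀ {x} → x ∈ E → x ≢ g → x ≢ m → Separates x g m → Obstacle
        swing : ∀ {f} → f ∈ E′ → f ∉ D′ → b ∈ᵥ f → f ≢ m →
          (∀ {d} → d ∈ D′ → (a ∈ᵥ d → d ~ f) × (d ~ f → a ∈ᵥ d)) → Obstacle
        fresh : ∀ {f} → f ∈ E′ → f ∉ D′ → b ∈ᵥ f → ¬ a ∈ᵥ f → m ∉ D′ → Same D′ m f →
          (∀ {x} → x ∈ E′ → a ∈ᵥ x → x ≢ m → x ~ f) → Obstacle

      from-collision : Collision P → Obstacle
      from-collision C with Collision.f C ≟ m
      ... | yes refl = level
        (λ d∈ b∈d → f∉ (subst (_∈ D′) (is-m (at-a (D′⊆E′ d∈) (proj₂ (same d∈) (b , b∈d , right Em))) b∈d) d∈))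
        f∉ x∈ x≢g x≢f apart
        where open Collision C
      ... | no f≢m = swing f∈ f∉ (at-b f∈ (~-sym h~f)) f≢m
        (λ d∈ → (proj₁ (same d∈) ∘ touch-a) , (at-a (D′⊆E′ d∈) ∘ proj₂ (same d∈)))
        where open Collision C

      -- If `e` were not `m`, then `m` would touch `e` at `a`, hence also its twin `f`, and that at
      -- `b`. So `h` would touch `f` and therefore `e`, and `e` would join `a` to `b` after all.
      from-new-pair : NewPair P → Obstacle
      from-new-pair N = go (e ≟ m)
        where
        open NewPair N
        a∈e = at-a e∈ (~-sym g~e)
        a∉f : ¬ a ∈ᵥ f
        a∉f a∈f = g≁f (~-sym (touch-a a∈f))
        go : Dec (e ≡ m) → Obstacle
        go (yes refl) = fresh f∈′ f∉ (at-b f∈′ (~-sym h~f)) a∉f e∉ same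
          (λ x∈ a∈x x≢m → proj₁ (twin x∈ x≢m (λ { refl → a∉f a∈x })) (a , a∈x , a∈e))
          where
          h~f = proj₁ h~ (b , right Eh , right Em)
          f∈′ = ~→∈ P h~f f∈
        go (no e≢m) = ⊥-elim (e≢m (is-m a∈e (at-b e∈ (~-sym (proj₂ h~ (b , right Eh , b∈f))))))
          where
          b∈f : b ∈ᵥ f
          b∈f = case ~-ends Em (~-sym (proj₁ (twin m∈ (≢-sym e≢m) (λ { refl → a∉f (left Em) }))
                                         (a , left Em , a∈e))) of λ
            { (inj₁ a∈f) → ⊥-elim (a∉f a∈f) ; (inj₂ b∈f) → b∈f }

      outcome : Solution E ⊎ Obstacle
      outcome = case good-or-bad E (h ∷ D′) of λ
        { (inj₁ good) → inj₁ (add-h good)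
        ; (inj₂ bad) → inj₂ (Sum.[ from-collision , from-new-pair ]′ (failure P h~g bad)) }

      m≁→⊥ : ∀ {f} → f ∈ E′ → f ∉ D′ → f ≢ m → m ~ f → (∀ {d} → d ∈ D′ → d ≁ f) → ⊥
      m≁→⊥ f∈ f∉ f≢m m~f undominated = undominated→isolated f∈ f∉ undominated m∈ (≢-sym f≢m) m~f

      -- Write `f′` as `aq`. Then `f` touches it and must be `bq`. As `m` and `f′` have the same
      -- trace, a chosen edge touching `f` would be one of `m`, `f`, `f′`, and none of these is
      -- chosen. So `f` is undominated although it touches `m`.
      fresh-clash : ∀ {f f′} → f ∈ E′ → f ∉ D′ → b ∈ᵥ f → f ≢ m →
        f′ ∈ E′ → f′ ∉ D′ → a ∈ᵥ f′ → ¬ b ∈ᵥ f′ → m ∉ D′ → Same D′ m f′ →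
        (∀ {x} → x ∈ E′ → b ∈ᵥ x → x ≢ m → x ~ f′) → ⊥
      fresh-clash {f} {f′} f∈ f∉ b∈f f≢m f′∈ f′∉ a∈f′ b∉f′ m∉ same near
        with q , Ef′ ← ends a∈f′ = m≁→⊥ f∈ f∉ f≢m (b , right Em , b∈f) undominated
        where
        a∉ : ∀ {x} → b ∈ᵥ x → x ≢ m → ¬ a ∈ᵥ x
        a∉ b∈x x≢m a∈x = x≢m (is-m a∈x b∈x)
        q∈f : q ∈ᵥ f
        q∈f = Sum.[ ⊥-elim ∘ a∉ b∈f f≢m , id ]′ (~-ends Ef′ (near f∈ b∈f f≢m))
        Ef : Ends′ f b q
        Ef = case ends b∈f of λ { (r , E) → case only E q∈f of λ
          { (inj₁ refl) → ⊥-elim (b∉f′ (right Ef′)) ; (inj₂ refl) → E } }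
        no-b : ∀ {d} → d ∈ D′ → ¬ b ∈ᵥ d
        no-b d∈ b∈d = case ~-ends Ef′ (proj₁ (same d∈) (b , b∈d , right Em)) of λ
          { (inj₁ a∈d) → m∉ (subst (_∈ D′) (is-m a∈d b∈d) d∈)
          ; (inj₂ q∈d) → f∉ (subst (_∈ D′) (simple (distinct Ef) b∈d q∈d b∈f q∈f) d∈) }
        undominated : ∀ {d} → d ∈ D′ → d ≁ f
        undominated d∈ d~f = case ~-ends Ef d~f of λ
          { (inj₁ b∈d) → no-b d∈ b∈d
          ; (inj₂ q∈d) → case ~-ends Em (proj₂ (same d∈) (q , q∈d , right Ef′)) of λ
              { (inj₁ a∈d) → f′∉ (subst (_∈ D′) (simple (distinct Ef′) a∈d q∈d a∈f′ (right Ef′)) d∈)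
              ; (inj₂ b∈d) → no-b d∈ b∈d } }

      -- Both `g` and `m` are touched by `h` and by every surviving edge at `a`, so only an edge at
      -- `b` can separate them.
      apart-at-b : ∀ {x} → x ∈ E → x ≢ g → x ≢ m → Separates x g m → (∀ {x} → x ∈ E′ → b ∈ᵥ x → x ≢ m → ⊥) → ⊥
      apart-at-b x∈ x≢g x≢m apart none = case split₂ x∈ of λ
        { (inj₁ eq) → x≢g eq
        ; (inj₂ (inj₁ refl)) → case apart of λ
            { (inj₁ (_ , h≁m)) → h≁m (b , right Eh , right Em) ; (inj₂ (_ , h≁g)) → h≁g h~g }
        ; (inj₂ (inj₂ x∈′)) → case apart of λ
            { (inj₁ (x~g , x≁m)) → x≁m (a , at-a x∈′ x~g , left Em)
            ; (inj₂ (x~m , x≁g)) → case ~-ends Em x~m of λ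
                { (inj₁ a∈x) → x≁g (touch-a a∈x) ; (inj₂ b∈x) → none x∈′ b∈x x≢m } } }

      level-fresh : (∀ {d} → d ∈ D′ → ¬ b ∈ᵥ d) → ∀ {x} → x ∈ E → x ≢ g → x ≢ m → Separates x g m →
        ∀ {f′} → f′ ∈ E′ → f′ ∉ D′ → a ∈ᵥ f′ → ¬ b ∈ᵥ f′ → m ∉ D′ → Same D′ m f′ →
        (∀ {x} → x ∈ E′ → b ∈ᵥ x → x ≢ m → x ~ f′) → ⊥
      level-fresh no-b x∈ x≢g x≢m apart f′∈ f′∉ a∈f′ b∉f′ m∉ same near =
        apart-at-b x∈ x≢g x≢m apart (λ x∈ b∈x x≢m →
          fresh-clash x∈ (λ x∈D → no-b x∈D b∈x) b∈x x≢m f′∈ f′∉ a∈f′ b∉f′ m∉ same near)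

      level-swing : (∀ {d} → d ∈ D′ → ¬ b ∈ᵥ d) → ∀ {f′} → f′ ∈ E′ → f′ ∉ D′ → a ∈ᵥ f′ → f′ ≢ m →
        (∀ {d} → d ∈ D′ → (b ∈ᵥ d → d ~ f′) × (d ~ f′ → b ∈ᵥ d)) → ⊥
      level-swing no-b f′∈ f′∉ a∈f′ f′≢m cut = m≁→⊥ f′∈ f′∉ f′≢m (a , left Em , a∈f′)
        (λ d∈ d~f′ → no-b d∈ (proj₂ (cut d∈) d~f′))

      level-level : (∀ {d} → d ∈ D′ → ¬ b ∈ᵥ d) → (∀ {d} → d ∈ D′ → ¬ a ∈ᵥ d) → m ∉ D′ →
        ∀ {x} → x ∈ E → x ≢ g → x ≢ m → Separates x g m → ⊥
      level-level no-b no-a m∉ x∈ x≢g x≢m apart =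
        apart-at-b x∈ x≢g x≢m apart (λ x∈ b∈x x≢m → undominated→isolated m∈ m∉
          (λ d∈ d~m → Sum.[ no-a d∈ , no-b d∈ ]′ (~-ends Em d~m)) x∈ x≢m (b , b∈x , right Em))

      record Swings : Set where
        field
          {f f′} : A
          f∈   : f ∈ E′
          f∉   : f ∉ D′
          b∈f  : b ∈ᵥ f
          f≢m  : f ≢ m
          cut  : ∀ {d} → d ∈ D′ → (a ∈ᵥ d → d ~ f) × (d ~ f → a ∈ᵥ d)
          f′∈  : f′ ∈ E′
          f′∉  : f′ ∉ D′
          a∈f′ : a ∈ᵥ f′
          f′≢m : f′ ≢ m
          cut′ : ∀ {d} → d ∈ D′ → (b ∈ᵥ d → d ~ f′) × (d ~ f′ → b ∈ᵥ d)

    flip-swings : ∀ {v a b m} {Δ : Deg2 v a b} {P : Pruned₂ Δ} {Em : Ends′ m a b} {m∈ : m ∈ Pruned.E′ P} →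
      Triangle.Swings Δ P Em m∈ → Triangle.Swings (flip₂ Δ) (flip-pruned P) (flip-ends Em) m∈
    flip-swings {Δ = Δ} {P} {Em} {m∈} W = record
      { f∈ = f′∈ ; f∉ = f′∉ ; b∈f = a∈f′ ; f≢m = f′≢m ; cut = cut′
      ; f′∈ = f∈ ; f′∉ = f∉ ; a∈f′ = b∈f ; f′≢m = f≢m ; cut′ = cut }
      where open Triangle.Swings W

    -- The chosen edges at a and b reduce to m, which is exchanged for f and f′.
    module Swing {v a b m} (Δ : Deg2 v a b) (P : Pruned₂ Δ)
      (Em : Ends′ m a b) (m∈ : m ∈ Pruned.E′ P) (W : Triangle.Swings Δ P Em m∈) where

      open Deg2 Δ
      open Pruned P
      open Triangle Δ P Em m∈
      open Swings W

      a∉f : ¬ a ∈ᵥ f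
      a∉f a∈f = f≢m (is-m a∈f b∈f)

      f≢f′ : f ≢ f′
      f≢f′ refl = a∉f a∈f′

      a→m : ∀ {d} → d ∈ D′ → a ∈ᵥ d → d ≡ m
      a→m d∈ a∈d = is-m a∈d (proj₂ (cut′ d∈) (a , a∈d , a∈f′))

      f→m : ∀ {d} → d ∈ D′ → d ~ f → d ≡ m
      f→m d∈ d~f = a→m d∈ (proj₂ (cut d∈) d~f)

      f′→m : ∀ {d} → d ∈ D′ → d ~ f′ → d ≡ m
      f′→m d∈ d~f′ = is-m (proj₂ (cut d∈) (b , b∈d , b∈f)) b∈d
        where b∈d = proj₂ (cut′ d∈) d~f′

      m~f : m ~ f
      m~f = b , right Em , b∈f

      m~f′ : m ~ f′
      m~f′ = a , left Em , a∈f′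

      m∈D : m ∈ D′
      m∈D with m ∈? D′
      ... | yes m∈D = m∈D
      ... | no m∉D = ⊥-elim (m≁→⊥ f∈ f∉ f≢m m~f (λ d∈ d~f → m∉D (subst (_∈ D′) (f→m d∈ d~f) d∈)))

      same-f : ∀ {x} → m ~ x → (∀ {d} → d ∈ D′ → d ~ x → d ≡ m) → Same D′ x f
      same-f m~x x→m d∈ = (λ d~x → case x→m d∈ d~x of λ { refl → m~f })
                        , (λ d~f → case f→m d∈ d~f of λ { refl → m~x })

      f′-f-twin : ∀ {x} → x ∈ E′ → x ≢ f′ → x ≢ f → x ~ f′ → x ~ f
      f′-f-twin x∈ x≢f′ x≢f =
        proj₁ (same→twin (there f′∈) (there f∈) f′∉ f∉ (same-f m~f′ f′→m) x∈ x≢f′ x≢f)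

      -- If `x` were not `f′`: `x` is `az`, and both it and `f` have only `m` in their trace, so
      -- they are twins in `E′`. The edge `f′` touches `x` at `a`, hence touches `f`, which is
      -- possible only at `z`.
      chord→f′ : ∀ {x z} → x ∈ E′ → x ≢ m → a ∈ᵥ x → Ends′ f b z → z ∈ᵥ x → x ≡ f′
      chord→f′ {x} {z} x∈ x≢m a∈x Ef z∈x with x ≟ f′
      ... | yes x≡f′ = x≡f′
      ... | no x≢f′ = case ~-ends Ef f′~f of λ
          { (inj₁ b∈f′) → ⊥-elim (f′≢m (is-m a∈f′ b∈f′))
          ; (inj₂ z∈f′) → simple a≢z a∈x z∈x a∈f′ z∈f′ }
        where
        a≢z : a ≢ z
        a≢z refl = a∉f (right Ef)
        Ex : Ends′ x a z
        Ex = case ends a∈x of λ { (y , E) → case only E z∈x of λ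
          { (inj₁ refl) → ⊥-elim (a≢z refl) ; (inj₂ refl) → E } }
        x→m : ∀ {d} → d ∈ D′ → d ~ x → d ≡ m
        x→m d∈ d~x = case ~-ends Ex d~x of λ
          { (inj₁ a∈d) → a→m d∈ a∈d ; (inj₂ z∈d) → f→m d∈ (z , z∈d , right Ef) }
        f′~f : f′ ~ f
        f′~f = proj₁ (same→twin (there x∈) (there f∈) (λ x∈D → x≢m (a→m x∈D a∈x)) f∉
          (same-f (a , left Em , a∈x) x→m) f′∈ (≢-sym x≢f′) (≢-sym f≢f′)) (a , a∈f′ , a∈x)

      -- Also `f′` and `f` are twins in `E′`, so `x`, which touches `f′`, touches `f`. It cannot do
      -- so at `b`, and at the other end of `f` it is the chord treated above.
      edges-at-a : ∀ {x} → x ∈ E′ → a ∈ᵥ x → x ≢ m → x ≡ f′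
      edges-at-a {x} x∈ a∈x x≢m with x ≟ f′ | ends b∈f
      ... | yes x≡f′ | _ = x≡f′
      ... | no x≢f′ | z , Ef =
        case ~-ends Ef (f′-f-twin x∈ x≢f′ (λ { refl → a∉f a∈x }) (a , a∈x , a∈f′)) of λ
          { (inj₁ b∈x) → ⊥-elim (x≢m (is-m a∈x b∈x))
          ; (inj₂ z∈x) → chord→f′ x∈ x≢m a∈x Ef z∈x }

    module Exchange {v a b m} (Δ : Deg2 v a b) (P : Pruned₂ Δ)
      (Em : Ends′ m a b) (m∈ : m ∈ Pruned.E′ P) (W : Triangle.Swings Δ P Em m∈) where

      open Deg2 Δ
      open Pruned P
      open Triangle Δ P Em m∈
      open Swings W

      open AtDeg2 Δ P
      open Swing Δ P Em m∈ W
      open Swing (flip₂ Δ) (flip-pruned P) (flip-ends Em) m∈ (flip-swings {Δ = Δ} {P} W) using ()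
        renaming (a∉f to b∉f′; edges-at-a to edges-at-b; a→m to b→m)

      -- Two edges enter and one leaves; the net gain of one is paid for by the two deleted edges.
      D : List A
      D = f ∷ f′ ∷ remove m D′

      keep : ∀ {d} → d ∈ D′ → d ≢ m → d ∈ D
      keep d∈ d≢m = there (there (∈-∖⁺ (m ∷ []) d∈ λ { (here eq) → d≢m eq }))

      data Kind : A → Set where
        the-g : Kind g
        the-h : Kind h
        the-m : Kind m
        other : ∀ {e} → e ∈ null ∷ E′ → e ∉ D′ → ¬ a ∈ᵥ e → ¬ b ∈ᵥ e → e ≁ g → e ≁ h → Kind e

      kind : ∀ {e} → e ∈ null ∷ E → e ∉ D → Kind e
      kind (here refl) e∉ = other (here refl) (null∉E ∘ E′⊆E ∘ D′⊆E′) null-empty null-empty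
        (λ { (_ , r∈ , _) → null-empty r∈ }) (λ { (_ , r∈ , _) → null-empty r∈ })
      kind {e} (there e∈) e∉ with split₂ e∈ | e ≟ m
      ... | inj₁ refl | _ = the-g
      ... | inj₂ (inj₁ refl) | _ = the-h
      ... | inj₂ (inj₂ _) | yes refl = the-m
      ... | inj₂ (inj₂ e∈′) | no e≢m =
        other (there e∈′) (λ e∈D → e∉ (keep e∈D e≢m)) a∉e b∉e (a∉e ∘ at-a e∈′) (b∉e ∘ at-b e∈′)
        where
        a∉e : ¬ a ∈ᵥ e
        a∉e a∈e = e∉ (there (here (edges-at-a e∈′ a∈e e≢m)))
        b∉e : ¬ b ∈ᵥ e
        b∉e b∈e = e∉ (here (edges-at-b e∈′ b∈e e≢m))

      f≁g : f ≁ g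
      f≁g f~g = a∉f (at-a f∈ f~g)

      f′≁h : f′ ≁ h
      f′≁h f′~h = b∉f′ (at-b f′∈ f′~h)

      lonely : ∀ {e k} → e ∈ null ∷ E′ → e ∉ D′ → m ≁ e → k ∈ E′ → k ~ e → k ∈ D →
        ¬ (∀ {d} → d ∈ D′ → d ≢ m → d ≁ e)
      lonely e∈ e∉ m≁e k∈ k~e k∈D none = undominated→isolated e∈′ e∉ undominated k∈
          (λ { refl → case k∈D of λ
            { (here refl) → m≁e m~f ; (there (here refl)) → m≁e m~f′
            ; (there (there k∈)) → e∉ (proj₁ (∈-∖⁻ (m ∷ []) k∈)) } }) k~e
        where
        e∈′ = ~→∈ P k~e e∈
        undominated : ∀ {d} → d ∈ D′ → d ≁ _
        undominated {d} d∈ d~e with d ≟ m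
        ... | yes refl = m≁e d~e
        ... | no d≢m = none d∈ d≢m d~e

      -- In `D′` only `m` meets `a` or `b`, so no other edge of `D′` touches `g`, `h` or `m`. An `e`
      -- whose trace lies under theirs is therefore undominated by `D′`, yet it has the neighbour
      -- `k`.
      clash-m : ∀ {e k} → e ∈ null ∷ E′ → e ∉ D′ → ¬ a ∈ᵥ e → ¬ b ∈ᵥ e → k ~ e → k ∈ D → k ∈ E′ →
        (∀ {d} → d ∈ D → d ~ e → d ~ m ⊎ d ~ g ⊎ d ~ h) → ⊥
      clash-m e∈ e∉ a∉e b∉e k~e k∈D k∈ shadow = lonely e∈ e∉ m≁e k∈ k~e k∈D
        (λ d∈ d≢m d~e → d≢m (case shadow (keep d∈ d≢m) d~e of λ
          { (inj₁ d~m) → Sum.[ a→m d∈ , b→m d∈ ]′ (~-ends Em d~m)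
          ; (inj₂ (inj₁ d~g)) → a→m d∈ (at-a (D′⊆E′ d∈) d~g)
          ; (inj₂ (inj₂ d~h)) → b→m d∈ (at-b (D′⊆E′ d∈) d~h) }))
        where
        m≁e : m ≁ _
        m≁e m~e = Sum.[ a∉e , b∉e ]′ (~-ends Em (~-sym m~e))

      g-other : ∀ {e} → e ∈ null ∷ E′ → e ∉ D′ → ¬ a ∈ᵥ e → ¬ b ∈ᵥ e → ¬ Same D g e
      g-other e∈ e∉ a∉ b∉ s = clash-m e∈ e∉ a∉ b∉ (proj₁ (s (there (here refl))) (touch-a a∈f′))
        (there (here refl)) f′∈ (λ d∈ → inj₂ ∘ inj₁ ∘ proj₂ (s d∈))

      h-other : ∀ {e} → e ∈ null ∷ E′ → e ∉ D′ → ¬ a ∈ᵥ e → ¬ b ∈ᵥ e → ¬ Same D h e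
      h-other e∈ e∉ a∉ b∉ s = clash-m e∈ e∉ a∉ b∉ (proj₁ (s (here refl)) (touch-b b∈f))
        (here refl) f∈ (λ d∈ → inj₂ ∘ inj₂ ∘ proj₂ (s d∈))

      m-other : ∀ {e} → e ∈ null ∷ E′ → e ∉ D′ → ¬ a ∈ᵥ e → ¬ b ∈ᵥ e → ¬ Same D m e
      m-other e∈ e∉ a∉ b∉ s = clash-m e∈ e∉ a∉ b∉ (proj₁ (s (here refl)) (~-sym m~f))
        (here refl) f∈ (λ d∈ → inj₁ ∘ proj₂ (s d∈))

      g-h : ¬ Same D g h
      g-h s = f≁g (proj₂ (s (here refl)) (touch-b b∈f))

      g-m : ¬ Same D g m
      g-m s = f≁g (proj₂ (s (here refl)) (~-sym m~f))

      h-m : ¬ Same D h m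
      h-m s = f′≁h (proj₂ (s (there (here refl))) (~-sym m~f′))

      located : ∀ {e k x} → Kind e → Kind k → Same D e k → x ∈ E → x ≢ e → x ≢ k → x ~ e → x ~ k
      located the-g the-g _ _ _ _ x~ = x~
      located the-h the-h _ _ _ _ x~ = x~
      located the-m the-m _ _ _ _ x~ = x~
      located the-g the-h s = ⊥-elim (g-h s)
      located the-h the-g s = ⊥-elim (g-h (same-sym s))
      located the-g the-m s = ⊥-elim (g-m s)
      located the-m the-g s = ⊥-elim (g-m (same-sym s))
      located the-h the-m s = ⊥-elim (h-m s)
      located the-m the-h s = ⊥-elim (h-m (same-sym s))
      located the-g (other e∈ e∉ a∉ b∉ _ _) s = ⊥-elim (g-other e∈ e∉ a∉ b∉ s)
      located the-h (other e∈ e∉ a∉ b∉ _ _) s = ⊥-elim (h-other e∈ e∉ a∉ b∉ s)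
      located the-m (other e∈ e∉ a∉ b∉ _ _) s = ⊥-elim (m-other e∈ e∉ a∉ b∉ s)
      located (other e∈ e∉ a∉ b∉ _ _) the-g s = ⊥-elim (g-other e∈ e∉ a∉ b∉ (same-sym s))
      located (other e∈ e∉ a∉ b∉ _ _) the-h s = ⊥-elim (h-other e∈ e∉ a∉ b∉ (same-sym s))
      located (other e∈ e∉ a∉ b∉ _ _) the-m s = ⊥-elim (m-other e∈ e∉ a∉ b∉ (same-sym s))
      located {e} {k} (other e∈ e∉ a∉ b∉ e≁g e≁h) (other k∈ k∉ a∉′ b∉′ _ _) s x∈ x≢e x≢k x~e =
        case split₂ x∈ of λ
          { (inj₁ refl) → ⊥-elim (e≁g (~-sym x~e))
          ; (inj₂ (inj₁ refl)) → ⊥-elim (e≁h (~-sym x~e))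
          ; (inj₂ (inj₂ x∈′)) → proj₁ (same→twin e∈ k∈ e∉ k∉ same′ x∈′ x≢e x≢k) x~e }
        where
        -- The removed `m` makes no difference, for it touches neither of two edges that avoid `a`
        -- and `b`.
        same′ : Same D′ e k
        same′ {d} d∈ with d ≟ m
        ... | yes refl = (λ m~e → ⊥-elim (Sum.[ a∉ , b∉ ]′ (~-ends Em (~-sym m~e))))
                       , (λ m~k → ⊥-elim (Sum.[ a∉′ , b∉′ ]′ (~-ends Em (~-sym m~k))))
        ... | no d≢m = s (keep d∈ d≢m)

      D⊆ : ∀ {d} → d ∈ D → d ∈ E
      D⊆ (here refl) = E′⊆E f∈
      D⊆ (there (here refl)) = E′⊆E f′∈
      D⊆ (there (there d∈)) = E′⊆E (D′⊆E′ (proj₁ (∈-∖⁻ (m ∷ []) d∈)))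

      D-unique : Unique D
      D-unique = (f≢f′ ∷ All.tabulate (λ d∈ → λ { refl → f∉ (proj₁ (∈-∖⁻ (m ∷ []) d∈)) }))
               ∷ All.tabulate (λ d∈ → λ { refl → f′∉ (proj₁ (∈-∖⁻ (m ∷ []) d∈)) })
               ∷ ∖-unique (m ∷ []) D′-unique

      solution : Solution E
      solution = mkSolution D D⊆ D-unique
        (≤-trans (≤-reflexive (trans (cong (λ k → 2 * suc k) (sym (length-remove D′-unique m∈D)))
                                     (*-distribˡ-+ 2 1 (length D′))))
                 (≤-trans (+-monoˡ-≤ _ two) bound))
        (λ e∈ k∈ e∉ k∉ s → located (kind e∈ e∉) (kind k∈ k∉) s)

    -- Each of the two choices succeeds or meets an obstacle over the same `D′`. Of the nine pairs
    -- of obstacles, only two swings are compatible, and these allow the exchange.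
    triangle : ∀ {v a b m} → Deg2 v a b → m ∈ E → Ends′ m a b → Solution E
    triangle {v} {a} {b} {m} Δ m∈ Em = Sum.[ id , (λ o → Sum.[ id , combine o ]′ T′.outcome) ]′ T.outcome
      where
      open Deg2 Δ
      P = prune g∈ h∈ g≢h
      open Pruned P
      m∈′ : m ∈ E′
      m∈′ = case split₂ m∈ of λ
        { (inj₁ refl) → ⊥-elim (Sum.[ distinct Eh ∘ sym , a≢b ∘ sym ]′ (only Eg (right Em)))
        ; (inj₂ (inj₁ refl)) → ⊥-elim (Sum.[ distinct Eg ∘ sym , a≢b ]′ (only Eh (left Em)))
        ; (inj₂ (inj₂ m∈′)) → m∈′ }
      module T = Triangle Δ P Em m∈′
      module T′ = Triangle (flip₂ Δ) (flip-pruned P) (flip-ends Em) m∈′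
      combine : T.Obstacle → T′.Obstacle → Solution E
      combine (T.level b∉ m∉ x∈ x≢g x≢m sep) (T′.level a∉ _ _ _ _ _) =
        ⊥-elim (T.level-level b∉ a∉ m∉ x∈ x≢g x≢m sep)
      combine (T.level b∉ _ _ _ _ _) (T′.swing f∈ f∉ a∈f f≢m cut) = ⊥-elim (T.level-swing b∉ f∈ f∉ a∈f f≢m cut)
      combine (T.level b∉ _ x∈ x≢g x≢m sep) (T′.fresh f∈ f∉ a∈f b∉f m∉ s near) =
        ⊥-elim (T.level-fresh b∉ x∈ x≢g x≢m sep f∈ f∉ a∈f b∉f m∉ s near)
      combine (T.swing f∈ f∉ b∈f f≢m cut) (T′.level a∉ _ _ _ _ _) = ⊥-elim (T′.level-swing a∉ f∈ f∉ b∈f f≢m cut)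
      combine (T.swing f∈ f∉ b∈f f≢m cut) (T′.swing f′∈ f′∉ a∈f′ f′≢m cut′) = Exchange.solution Δ P Em m∈′ record
        { f∈ = f∈ ; f∉ = f∉ ; b∈f = b∈f ; f≢m = f≢m ; cut = cut
        ; f′∈ = f′∈ ; f′∉ = f′∉ ; a∈f′ = a∈f′ ; f′≢m = f′≢m ; cut′ = cut′ }
      combine (T.swing f∈ f∉ b∈f f≢m _) (T′.fresh f′∈ f′∉ a∈f′ b∉f′ m∉ s near) =
        ⊥-elim (T.fresh-clash f∈ f∉ b∈f f≢m f′∈ f′∉ a∈f′ b∉f′ m∉ s near)
      combine (T.fresh f∈ f∉ b∈f a∉f m∉ s near) (T′.level a∉ _ x∈ x≢h x≢m sep) =
        ⊥-elim (T′.level-fresh a∉ x∈ x≢h x≢m sep f∈ f∉ b∈f a∉f m∉ s near)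
      combine (T.fresh f∈ f∉ b∈f a∉f m∉ s near) (T′.swing f′∈ f′∉ a∈f′ f′≢m _) =
        ⊥-elim (T′.fresh-clash f′∈ f′∉ a∈f′ f′≢m f∈ f∉ b∈f a∉f m∉ s near)
      combine (T.fresh f∈ f∉ b∈f a∉f m∉ s near) (T′.fresh f′∈ f′∉ a∈f′ b∉f′ _ s′ near′) =
        ⊥-elim (T.fresh-clash f∈ f∉ b∈f (λ { refl → a∉f (left Em) }) f′∈ f′∉ a∈f′ b∉f′ m∉ s′ near′)

    -- A vertex of degree 2 with nonadjacent neighbours.

    ends-at : ∀ {x p q} → p ≢ q → p ∈ᵥ x → q ∈ᵥ x → Ends′ x p q
    ends-at p≢q p∈x q∈x with ends p∈x
    ... | r , Ex with only Ex q∈x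
    ...   | inj₁ refl = ⊥-elim (p≢q refl)
    ...   | inj₂ refl = Ex

    deg2 : ∀ {v a b g h} → g ∈ E → h ∈ E → Ends′ g v a → Ends′ h v b → a ≢ b →
      (∀ {x} → x ∈ E → v ∈ᵥ x → x ≡ g ⊎ x ≡ h) → Deg2 v a b
    deg2 g∈ h∈ Eg Eh a≢b at-v = record { g∈ = g∈ ; h∈ = h∈ ; Eg = Eg ; Eh = Eh ; a≢b = a≢b ; at-v = at-v }

    -- Besides `f` itself, only edges `ya` and `za` can touch `f`. With both, `y` has degree 2 in a
    -- triangle; with one, there is a leaf next to a vertex of degree 2; with none, `f` is isolated.
    cap : ∀ {f y z a} → f ∈ E → Ends′ f y z → ¬ a ∈ᵥ f → (∀ {x} → x ∈ E → x ~ f → x ≡ f ⊎ a ∈ᵥ x) →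
      Solution E ⊎ (∀ {x} → x ∈ E → x ~ f → x ≡ f)
    cap {f} {y} {z} {a} f∈ Ef a∉f around with edge? y a | edge? z a
    ... | no ya | no za = inj₂ (λ {x} x∈ x~f → case around x∈ x~f of λ
          { (inj₁ eq) → eq
          ; (inj₂ a∈x) → case ~-ends Ef x~f of λ
              { (inj₁ y∈x) → ⊥-elim (ya (x , x∈ , y∈x , a∈x)) ; (inj₂ z∈x) → ⊥-elim (za (x , x∈ , z∈x , a∈x)) } })
    ... | yes (k , k∈ , y∈k , a∈k) | za = inj₁ (turn za)
      where
      a≢y : a ≢ y
      a≢y refl = a∉f (left Ef)
      Δ : Deg2 y z a
      Δ = deg2 f∈ k∈ Ef (ends-at (≢-sym a≢y) y∈k a∈k) (λ { refl → a∉f (right Ef) })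
        (λ x∈ y∈x → Sum.map₂ (λ a∈x → simple (≢-sym a≢y) y∈x a∈x y∈k a∈k) (around x∈ (y , y∈x , left Ef)))
      turn : Dec (Edge′ z a) → Solution E
      turn (yes (j , j∈ , z∈j , a∈j)) = triangle Δ j∈ (ends-at (λ { refl → a∉f (right Ef) }) z∈j a∈j)
      turn (no za) = leg Δ (λ {x} x∈ z∈x → Sum.[ id , (λ a∈x → ⊥-elim (za (x , x∈ , z∈x , a∈x))) ]′
                                         (around x∈ (z , z∈x , right Ef)))
    ... | no ya | yes (k , k∈ , z∈k , a∈k) = inj₁ (leg Δ
          (λ {x} x∈ y∈x → Sum.[ id , (λ a∈x → ⊥-elim (ya (x , x∈ , y∈x , a∈x))) ]′ (around x∈ (y , y∈x , left Ef))))
      where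
      a≢z : a ≢ z
      a≢z refl = a∉f (right Ef)
      Δ : Deg2 z y a
      Δ = deg2 f∈ k∈ (flip-ends Ef) (ends-at (≢-sym a≢z) z∈k a∈k) (λ { refl → a∉f (left Ef) })
        (λ x∈ z∈x → Sum.map₂ (λ a∈x → simple (≢-sym a≢z) z∈x a∈x z∈k a∈k) (around x∈ (z , z∈x , right Ef)))

    -- Here `a` carries the leaf `q`, so all edges that touch `l` contain `a`. The surviving
    -- failures leave `l` isolated after the deletion, which is a case for `leg`, or give it a twin
    -- away from `a`, which is a case for `cap`.
    module Support {v a b l q} (Δ : Deg2 v a b) (ab∉ : ¬ Edge′ a b)
      (l∈ : l ∈ E) (El : Ends′ l a q) (at-q : ∀ {x} → x ∈ E → q ∈ᵥ x → x ≡ l) where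

      open Deg2 Δ

      P : Pruned g h
      P = prune g∈ h∈ g≢h

      open Pruned P
      open AtDeg2 Δ P

      a∉h : ¬ a ∈ᵥ h
      a∉h a∈h = Sum.[ distinct Eg ∘ sym , a≢b ]′ (only Eh a∈h)

      l≢g : l ≢ g
      l≢g refl = Sum.[ (λ { refl → g≢h (sym (at-q h∈ (left Eh))) }) , distinct El ∘ sym ]′ (only Eg (right El))

      l∈′ : l ∈ E′
      l∈′ = case split₂ l∈ of λ
        { (inj₁ l≡g) → ⊥-elim (l≢g l≡g) ; (inj₂ (inj₁ refl)) → ⊥-elim (a∉h (left El)) ; (inj₂ (inj₂ l∈′)) → l∈′ }

      isolated : (∀ {x} → x ∈ E′ → x ≢ l → x ≁ l) → Solution E
      isolated alone = leg (deg2 l∈ g∈ El (flip-ends Eg) (λ { refl → v∉ l∈′ (right El) }) at-a′) at-q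
        where
        at-a′ : ∀ {x} → x ∈ E → a ∈ᵥ x → x ≡ l ⊎ x ≡ g
        at-a′ {x} x∈ a∈x with split₂ x∈ | x ≟ l
        ... | _ | yes eq = inj₁ eq
        ... | inj₁ eq | no _ = inj₂ eq
        ... | inj₂ (inj₁ refl) | no _ = ⊥-elim (a∉h a∈x)
        ... | inj₂ (inj₂ x∈′) | no x≢l = ⊥-elim (alone x∈′ x≢l (a , a∈x , left El))

      -- A further edge touching `f` touches its twin `l`, and does so at `a`, because `q` is a
      -- leaf. So `cap` applies to `f`; and if `f` turns out isolated, then `l` is isolated in `E′`.
      twin-of-l : ∀ {f} → f ∈ null ∷ E′ → ¬ a ∈ᵥ f → ¬ b ∈ᵥ f →
        (∀ {x} → x ∈ E′ → x ≢ l → x ≢ f → (x ~ l → x ~ f) × (x ~ f → x ~ l)) → Solution E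
      twin-of-l {f} f∈ a∉f b∉f twin with shape f
      ... | inj₁ empty = isolated (λ { x∈ x≢l x~l@(_ , r∈x , _) → case proj₁ (twin x∈ x≢l (λ { refl → empty r∈x })) x~l of λ
            { (_ , _ , r∈f) → empty r∈f } })
      ... | inj₂ (y , z , Ef) = Sum.[ id , (λ alone → isolated (λ x∈ x≢l x~l →
              f≁l (subst (_~ l) (alone (E′⊆E x∈) (proj₁ (twin x∈ x≢l (λ { refl → f≁l x~l })) x~l)) x~l))) ]′
            (cap (E′⊆E f∈′) Ef a∉f around)
        where
        f∈′ : f ∈ E′
        f∈′ = ~→∈ P (y , left Ef , left Ef) f∈
        f≁l : f ≁ l
        f≁l f~l = case ~-ends El f~l of λ
          { (inj₁ a∈f) → a∉f a∈f ; (inj₂ q∈f) → a∉f (subst (a ∈ᵥ_) (sym (at-q (E′⊆E f∈′) q∈f)) (left El)) }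
        around : ∀ {x} → x ∈ E → x ~ f → x ≡ f ⊎ a ∈ᵥ x
        around {x} x∈ x~f with split₂ x∈ | x ≟ f
        ... | _ | yes eq = inj₁ eq
        ... | inj₁ refl | no _ = ⊥-elim (a∉f (at-a f∈′ (~-sym x~f)))
        ... | inj₂ (inj₁ refl) | no _ = ⊥-elim (b∉f (at-b f∈′ (~-sym x~f)))
        ... | inj₂ (inj₂ x∈′) | no x≢f = inj₂ (case x ≟ l of λ
              { (yes refl) → left El
              ; (no x≢l) → case ~-ends El (proj₂ (twin x∈′ x≢l x≢f) x~f) of λ
                  { (inj₁ a∈x) → a∈x ; (inj₂ q∈x) → ⊥-elim (x≢l (at-q x∈ q∈x)) } })

      new-pair : NewPair P → Solution E
      new-pair N with NewPair.e N ≟ l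
      ... | yes refl = twin-of-l f∈ (λ a∈f → g≁f (~-sym (touch-a a∈f)))
              (λ b∈f → case proj₂ h~ (~-sym (touch-b b∈f)) of λ h~l → ab∉ (l , l∈ , left El , at-b e∈ (~-sym h~l))) twin
        where open NewPair N
      ... | no e≢l = ⊥-elim (case ~-ends El (~-sym l~f) of λ
              { (inj₁ a∈f) → a∉f a∈f
              ; (inj₂ q∈f) → a∉f (subst (a ∈ᵥ_) (sym (at-q (E′⊆E (~→∈ P l~f f∈)) q∈f)) (left El)) })
        where
        open NewPair N
        a∉f : ¬ a ∈ᵥ f
        a∉f a∈f = g≁f (~-sym (touch-a a∈f))
        l~f : l ~ f
        l~f = proj₁ (twin l∈′ (≢-sym e≢l) (λ { refl → a∉f (left El) })) (a , left El , at-a e∈ (~-sym g~e))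

      module Collided (C : Collision P) where

        open Collision C

        b∈f : b ∈ᵥ f
        b∈f = at-b f∈ (~-sym h~f)

        a∉f : ¬ a ∈ᵥ f
        a∉f a∈f = ab∉ (f , E′⊆E f∈ , a∈f , b∈f)

        l∉D : l ∉ D′
        l∉D l∈D = case ~-ends El (~-sym (proj₁ (same l∈D) (touch-a (left El)))) of λ
          { (inj₁ a∈f) → a∉f a∈f ; (inj₂ q∈f) → a∉f (subst (a ∈ᵥ_) (sym (at-q (E′⊆E f∈) q∈f)) (left El)) }

        d~l→a : ∀ {d} → d ∈ D′ → d ~ l → a ∈ᵥ d
        d~l→a d∈ d~l = case ~-ends El d~l of λ
          { (inj₁ a∈d) → a∈d ; (inj₂ q∈d) → ⊥-elim (l∉D (subst (_∈ D′) (at-q (E′⊆E (D′⊆E′ d∈)) q∈d) d∈)) }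

        -- The chosen edges touching `l` are those at `a`, which are the ones touching `g`, and `f`
        -- collides with `g`.
        same-l : Same D′ l f
        same-l d∈ = (λ d~l → proj₁ (same d∈) (touch-a (d~l→a d∈ d~l)))
                  , (λ d~f → a , at-a (D′⊆E′ d∈) (proj₂ (same d∈) d~f) , left El)

        collision′ : Collision (flip-pruned P) → Solution E
        collision′ C′ = isolated (undominated→isolated l∈′ l∉D (λ d∈ d~l → no-a d∈ (d~l→a d∈ d~l)))
          where
          module C′ = Collision C′
          no-a : ∀ {d} → d ∈ D′ → ¬ a ∈ᵥ d
          no-a {d} d∈ a∈d = ab∉ (d , E′⊆E (D′⊆E′ d∈) , a∈d , at-b (D′⊆E′ d∈)
            (proj₂ (C′.same d∈) (a , a∈d , at-a C′.f∈ (~-sym C′.h~f))))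

        new-pair′ : NewPair (flip-pruned P) → Solution E
        new-pair′ N = pick (N.e ≟ f)
          where
          module N = NewPair N
          b∈e : b ∈ᵥ N.e
          b∈e = at-b N.e∈ (~-sym N.g~e)
          b∉f₂ : ¬ b ∈ᵥ N.f
          b∉f₂ b∈f₂ = N.g≁f (~-sym (touch-b b∈f₂))
          a∉f₂ : ¬ a ∈ᵥ N.f
          a∉f₂ a∈f₂ = ab∉ (N.e , E′⊆E N.e∈ , at-a N.e∈ (~-sym (proj₂ N.h~ (~-sym (touch-a a∈f₂)))) , b∈e)
          f₂∉l : ∀ {r} → r ∈ᵥ N.f → N.f ≁ l
          f₂∉l r∈ f₂~l = case ~-ends El f₂~l of λ
            { (inj₁ a∈f₂) → a∉f₂ a∈f₂
            ; (inj₂ q∈f₂) → a∉f₂ (subst (a ∈ᵥ_) (sym (at-q (E′⊆E (~→∈ P (_ , r∈ , r∈) N.f∈)) q∈f₂)) (left El)) }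
          pick : Dec (N.e ≡ f) → Solution E
          pick (yes refl) = twin-of-l N.f∈ a∉f₂ b∉f₂
            (same→twin (there l∈′) N.f∈ l∉D N.f∉ (same-trans same-l N.same))
          pick (no e≢f) = ⊥-elim (f₂∉l (proj₂ (proj₂ f~f₂)) (proj₂ (same→twin (there l∈′) (there f∈) l∉D f∉ same-l
              (~→∈ P f~f₂ N.f∈) (λ { refl → a∉f₂ (left El) }) (λ { refl → b∉f₂ b∈f })) (~-sym f~f₂)))
            where
            f~f₂ : f ~ N.f
            f~f₂ = proj₁ (N.twin f∈ (≢-sym e≢f) (λ { refl → b∉f₂ b∈f })) (b , b∈f , b∈e)

        solution : Solution E
        solution = choose-h (flip-pruned P) (~-sym h~g) collision′ new-pair′

      solution : Solution E
      solution = choose-h P h~g Collided.solution new-pair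

    -- A new pair e, f of disjoint edges, where g is the deleted edge at a.
    record Quad (g : A) (a w y z : V) : Set where
      field
        {e f} : A
        e∈    : e ∈ E
        f∈    : f ∈ E
        Ee    : Ends′ e a w
        Ef    : Ends′ f y z
        a∉f   : ¬ a ∈ᵥ f
        w∉f   : ¬ w ∈ᵥ f
        w∉g   : ¬ w ∈ᵥ g
        at-a  : ∀ {x} → x ∈ E → a ∈ᵥ x → x ≡ g ⊎ x ≡ e ⊎ x ~ f
        at-w  : ∀ {x} → x ∈ E → w ∈ᵥ x → x ≡ e ⊎ x ~ f
        at-f  : ∀ {x} → x ∈ E → x ~ f → x ≡ f ⊎ a ∈ᵥ x ⊎ w ∈ᵥ x

    flip-quad : ∀ {g a w y z} → Quad g a w y z → Quad g a w z y
    flip-quad Q = record { e∈ = e∈ ; f∈ = f∈ ; Ee = Ee ; Ef = flip-ends Ef ; a∉f = a∉f ; w∉f = w∉f ; w∉g = w∉g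
                         ; at-a = at-a ; at-w = at-w ; at-f = at-f }
      where open Quad Q

    -- Among the edges other than `e` and `f`, only `g` touches one of the two and not the other. If
    -- they are disjoint, each remaining edge that touches either joins them, so that they hang on
    -- the rest by `g` alone. That is a `Quad`.
    module Fresh {g h v a b} (Eg : Ends′ g v a) (Eh : Ends′ h v b) (g∈ : g ∈ E) (ab∉ : ¬ Edge′ a b)
      (P : Pruned g h) (N : NewPair P) (v∉e : ¬ v ∈ᵥ NewPair.e N) where

      open Pruned P
      open NewPair N

      a∈e : a ∈ᵥ e
      a∈e = Sum.[ ⊥-elim ∘ v∉e , id ]′ (~-ends Eg (~-sym g~e))

      a∉f : ¬ a ∈ᵥ f
      a∉f a∈f = g≁f (a , right Eg , a∈f)

      b∉e : ¬ b ∈ᵥ e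
      b∉e b∈e = ab∉ (e , E′⊆E e∈ , a∈e , b∈e)

      b∉f : ¬ b ∈ᵥ f
      b∉f b∈f = Sum.[ v∉e , b∉e ]′ (~-ends Eh (~-sym (proj₂ h~ (b , right Eh , b∈f))))

      at-f′ : ∀ {x} → x ∈ E → x ~ f → x ≡ f ⊎ x ~ e
      at-f′ {x} x∈ x~f with split₂ x∈ | x ≟ f | x ≟ e
      ... | _ | yes eq | _ = inj₁ eq
      ... | _ | no _ | yes refl = inj₂ (a , a∈e , a∈e)
      ... | inj₁ refl | no _ | no _ = ⊥-elim (g≁f x~f)
      ... | inj₂ (inj₁ refl) | no _ | no _ = inj₂ (proj₂ h~ x~f)
      ... | inj₂ (inj₂ x∈′) | no x≢f | no x≢e = inj₂ (proj₂ (twin x∈′ x≢e x≢f) x~f)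

      at-e : ∀ {x} → x ∈ E → x ~ e → x ≡ g ⊎ x ≡ e ⊎ x ~ f
      at-e {x} x∈ x~e with split₂ x∈ | x ≟ f | x ≟ e
      ... | inj₁ eq | _ | _ = inj₁ eq
      ... | _ | _ | yes eq = inj₂ (inj₁ eq)
      ... | inj₂ (inj₁ refl) | _ | no _ = inj₂ (inj₂ (proj₁ h~ x~e))
      ... | inj₂ (inj₂ x∈′) | yes refl | no _ = inj₂ (inj₂ (proj₁ x~e , proj₁ (proj₂ x~e) , proj₁ (proj₂ x~e)))
      ... | inj₂ (inj₂ x∈′) | no x≢f | no x≢e = inj₂ (inj₂ (proj₁ (twin x∈′ x≢e x≢f) x~e))

      module _ {w} (Ee : Ends′ e a w) where

        w∉g : ¬ w ∈ᵥ g
        w∉g w∈g = Sum.[ (λ { refl → v∉e (right Ee) }) , distinct Ee ∘ sym ]′ (only Eg w∈g)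

        at-w : ∀ {x} → x ∈ E → w ∈ᵥ x → x ≡ e ⊎ x ~ f
        at-w x∈ w∈x = case at-e x∈ (w , w∈x , right Ee) of λ
          { (inj₁ refl) → ⊥-elim (w∉g w∈x) ; (inj₂ rest) → rest }

        w≢v : w ≢ v
        w≢v refl = v∉e (right Ee)

        Δa : (∀ {x} → x ∈ E → a ∈ᵥ x → x ~ f → x ≡ e) → Deg2 a w v
        Δa near = deg2 (E′⊆E e∈) g∈ Ee (flip-ends Eg) w≢v (λ x∈ a∈x →
          case at-e x∈ (a , a∈x , a∈e) of λ
            { (inj₁ eq) → inj₂ eq ; (inj₂ (inj₁ eq)) → inj₁ eq ; (inj₂ (inj₂ x~f)) → inj₁ (near x∈ a∈x x~f) })

        hanging : (∀ {r} → ¬ r ∈ᵥ f) → Solution E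
        hanging empty = leg (Δa (λ _ _ (_ , _ , r∈) → ⊥-elim (empty r∈)))
          (λ x∈ w∈x → Sum.[ id , (λ { (_ , _ , r∈) → ⊥-elim (empty r∈) }) ]′ (at-w x∈ w∈x))

        -- An edge at `q` other than `f` touches `e` and can only be `aq`. If it exists, `q` has
        -- degree 2 in a triangle; if not, `q` is a leaf and `a` has degree 2.
        shared : ∀ {q} → f ∈ E → Ends′ f w q →
          (Deg2 a w v → (∀ {x} → x ∈ E → q ∈ᵥ x → x ≡ f) → Solution E) → Solution E
        shared {q} f∈E Ef on-pendant with edge? a q
        ... | yes (k , k∈ , a∈k , q∈k) = triangle
                (deg2 f∈E k∈ (flip-ends Ef) (ends-at (≢-sym a≢q) q∈k a∈k) (≢-sym (distinct Ee)) at-q)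
                (E′⊆E e∈) (flip-ends Ee)
          where
          a≢q : a ≢ q
          a≢q refl = a∉f (right Ef)
          at-q : ∀ {x} → x ∈ E → q ∈ᵥ x → x ≡ f ⊎ x ≡ k
          at-q x∈ q∈x = case at-f′ x∈ (q , q∈x , right Ef) of λ
            { (inj₁ eq) → inj₁ eq
            ; (inj₂ x~e) → case ~-ends Ee x~e of λ
                { (inj₁ a∈x) → inj₂ (simple a≢q a∈x q∈x a∈k q∈k)
                ; (inj₂ w∈x) → inj₁ (simple (distinct Ef) w∈x q∈x (left Ef) (right Ef)) } }
        ... | no aq∉ = on-pendant
                (Δa (λ {x} x∈ a∈x x~f → case ~-ends Ef x~f of λ
                  { (inj₁ w∈x) → simple (distinct Ee) a∈x w∈x a∈e (right Ee)
                  ; (inj₂ q∈x) → ⊥-elim (aq∉ (x , x∈ , a∈x , q∈x)) }))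
                (λ {x} x∈ q∈x → case at-f′ x∈ (q , q∈x , right Ef) of λ
                  { (inj₁ eq) → eq
                  ; (inj₂ x~e) → case ~-ends Ee x~e of λ
                      { (inj₁ a∈x) → ⊥-elim (aq∉ (x , x∈ , a∈x , q∈x))
                      ; (inj₂ w∈x) → simple (distinct Ef) w∈x q∈x (left Ef) (right Ef) } })

        quad : ∀ {y z} → f ∈ E → Ends′ f y z → ¬ w ∈ᵥ f → Quad g a w y z
        quad f∈E Ef w∉f = record
          { e∈ = E′⊆E e∈ ; f∈ = f∈E ; Ee = Ee ; Ef = Ef ; a∉f = a∉f ; w∉f = w∉f ; w∉g = w∉g
          ; at-a = λ x∈ a∈x → at-e x∈ (a , a∈x , a∈e) ; at-w = at-w
          ; at-f = λ x∈ x~f → Sum.map₂ (~-ends Ee) (at-f′ x∈ x~f) }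

    module Open₂ {v a b} (Δ : Deg2 v a b) (ab∉ : ¬ Edge′ a b) (P : Pruned₂ Δ) where

      open Deg2 Δ
      open Pruned P

      open AtDeg2 Δ P

      new-pair : (∀ {w y z} (Q : Quad g a w y z) → ¬ b ∈ᵥ Quad.e Q → ¬ b ∈ᵥ Quad.f Q → Solution E) →
        NewPair P → Solution E
      new-pair on-quad N with ends (at-a (NewPair.e∈ N) (~-sym (NewPair.g~e N))) | shape (NewPair.f N)
      ... | w , Ee | inj₁ empty = Fresh.hanging Eg Eh g∈ ab∉ P N (v∉ (NewPair.e∈ N)) Ee empty
      ... | w , Ee | inj₂ (y , z , Ef) = go (w ∈ᵥ? f)
        where
        open NewPair N
        open Fresh Eg Eh g∈ ab∉ P N (v∉ e∈)
        f∈E = E′⊆E (~→∈ P (y , left Ef , left Ef) f∈)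
        wv∉ : ¬ Edge′ w v
        wv∉ (x , x∈ , w∈x , v∈x) = case at-v x∈ v∈x of λ
          { (inj₁ refl) → w∉g Ee w∈x
          ; (inj₂ refl) → Sum.[ w≢v Ee , (λ { refl → b∉e (right Ee) }) ]′ (only Eh w∈x) }
        go : Dec (w ∈ᵥ f) → Solution E
        go (no w∉f) = on-quad (quad Ee f∈E Ef w∉f) b∉e b∉f
        go (yes w∈f) with q , Ef′ ← ends w∈f =
          shared Ee f∈E Ef′ (λ Δa at-q → Support.solution Δa wv∉ f∈E Ef′ at-q)

      -- A chosen edge at `a` would touch the edge colliding with `h`, hence `h` itself, and would
      -- join `a` to `b`. So none exists and `f` is undominated by `D′`, which makes `u` a leaf and
      -- `b` a vertex of degree 2.
      collision : Collision P → Collision (flip-pruned P) → Solution E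
      collision C C′ with ends (at-b (Collision.f∈ C) (~-sym (Collision.h~f C)))
      ... | u , Ef = leg (deg2 (E′⊆E f∈) h∈ Ef (flip-ends Eh) (λ { refl → v∉ f∈ (right Ef) }) at-b′) at-u
        where
        open Collision C
        module C′ = Collision C′
        no-a : ∀ {d} → d ∈ D′ → ¬ a ∈ᵥ d
        no-a {d} d∈ a∈d = ab∉ (d , E′⊆E (D′⊆E′ d∈) , a∈d , at-b (D′⊆E′ d∈)
          (proj₂ (C′.same d∈) (a , a∈d , at-a C′.f∈ (~-sym C′.h~f))))
        isolated : ∀ {x} → x ∈ E′ → x ≢ f → x ≁ f
        isolated = undominated→isolated f∈ f∉ (λ d∈ d~f → no-a d∈ (at-a (D′⊆E′ d∈) (proj₂ (same d∈) d~f)))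
        alone : ∀ {x} → x ∈ E′ → x ~ f → x ≡ f
        alone {x} x∈ x~f with x ≟ f
        ... | yes eq = eq
        ... | no x≢f = ⊥-elim (isolated x∈ x≢f x~f)
        u∉h : ¬ u ∈ᵥ h
        u∉h u∈h = Sum.[ (λ { refl → v∉ f∈ (right Ef) }) , distinct Ef ∘ sym ]′ (only Eh u∈h)
        at-b′ : ∀ {x} → x ∈ E → b ∈ᵥ x → x ≡ f ⊎ x ≡ h
        at-b′ x∈ b∈x = case split₂ x∈ of λ
          { (inj₁ refl) → ⊥-elim (Sum.[ distinct Eh ∘ sym , a≢b ∘ sym ]′ (only Eg b∈x))
          ; (inj₂ (inj₁ eq)) → inj₂ eq
          ; (inj₂ (inj₂ x∈′)) → inj₁ (alone x∈′ (b , b∈x , left Ef)) }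
        at-u : ∀ {x} → x ∈ E → u ∈ᵥ x → x ≡ f
        at-u {x} x∈ u∈x = case split₂ x∈ of λ
          { (inj₁ refl) → ⊥-elim (Sum.[ (λ { refl → v∉ f∈ (right Ef) })
                                      , (λ { refl → ab∉ (f , E′⊆E f∈ , right Ef , left Ef) }) ]′ (only Eg u∈x))
          ; (inj₂ (inj₁ refl)) → ⊥-elim (u∉h u∈x)
          ; (inj₂ (inj₂ x∈′)) → alone x∈′ (u , u∈x , right Ef) }

    -- The treatment of quads is a parameter to avoid a circle: quads are solved with the help of
    -- `square`, and `square` is this argument in a situation where no quad occurs.
    module Open₂-solution {v a b} (Δ : Deg2 v a b) (ab∉ : ¬ Edge′ a b)
      (on-quad : ∀ {w y z} (Q : Quad (Deg2.g Δ) a w y z) → ¬ b ∈ᵥ Quad.e Q → ¬ b ∈ᵥ Quad.f Q → Solution E)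
      (on-quad′ : ∀ {w y z} (Q : Quad (Deg2.h Δ) b w y z) → ¬ a ∈ᵥ Quad.e Q → ¬ a ∈ᵥ Quad.f Q → Solution E) where

      open Deg2 Δ

      P : Pruned g h
      P = prune g∈ h∈ g≢h

      ba∉ : ¬ Edge′ b a
      ba∉ (x , x∈ , b∈x , a∈x) = ab∉ (x , x∈ , a∈x , b∈x)

      solution : Solution E
      solution = choose-h P h~g
        (λ C → choose-h (flip-pruned P) (~-sym h~g) (Open₂.collision Δ ab∉ P C)
                 (Open₂.new-pair (flip₂ Δ) ba∉ (flip-pruned P) on-quad′))
        (Open₂.new-pair Δ ab∉ P on-quad)

    -- A second common neighbour c of a and b rules out disjoint new pairs.
    square : ∀ {v a b c k₁ k₂} → Deg2 v a b → ¬ Edge′ a b → k₁ ∈ E → Ends′ k₁ a c → k₂ ∈ E → Ends′ k₂ b c →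
      c ≢ v → Solution E
    square {v} {a} {b} {c} Δ ab∉ k₁∈ E₁ k₂∈ E₂ c≢v = Open₂-solution.solution Δ ab∉
      (λ Q b∉e b∉f → ⊥-elim (none ab∉ Q b∉e b∉f k₁∈ E₁ k₂∈ E₂ (c∉ Eg (distinct E₁))))
      (λ Q a∉e a∉f → ⊥-elim (none (λ { (x , x∈ , p , q) → ab∉ (x , x∈ , q , p) }) Q a∉e a∉f k₂∈ E₂ k₁∈ E₁ (c∉ Eh (distinct E₂))))
      where
      open Deg2 Δ
      c∉ : ∀ {g a} → Ends′ g v a → a ≢ c → ¬ c ∈ᵥ g
      c∉ Eg a≢c c∈g = Sum.[ c≢v , a≢c ∘ sym ]′ (only Eg c∈g)
      none : ∀ {g a b w y z k₁ k₂} → ¬ Edge′ a b → (Q : Quad g a w y z) →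
        ¬ b ∈ᵥ Quad.e Q → ¬ b ∈ᵥ Quad.f Q →
        k₁ ∈ E → Ends′ k₁ a c → k₂ ∈ E → Ends′ k₂ b c → ¬ c ∈ᵥ g → ⊥
      none {a = a} {b} {w} {y} {z} {k₁} {k₂} ab∉ Q b∉e b∉f k₁∈ E₁ k₂∈ E₂ c∉g =
        -- Since the edge `ac` is not `g`, the vertex `c` is `w` or an end of `f`. Then `bc` leaves
        -- the four vertices of the quad, which only `g` can do.
        case at-a k₁∈ (left E₁) of λ
          { (inj₁ refl) → c∉g (right E₁)
          ; (inj₂ (inj₁ refl)) → case only Ee (right E₁) of λ
              { (inj₁ refl) → distinct E₁ refl
              ; (inj₂ refl) → case at-w k₂∈ (right E₂) of λ
                  { (inj₁ refl) → b∉e (left E₂) ; (inj₂ k₂~f) → via-f k₂~f w∉f } }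
          ; (inj₂ (inj₂ k₁~f)) → case via k₁~f of λ c∈f → case at-f k₂∈ (c , right E₂ , c∈f) of λ
              { (inj₁ refl) → b∉f (left E₂)
              ; (inj₂ (inj₁ a∈k₂)) → ab∉ (k₂ , k₂∈ , a∈k₂ , left E₂)
              ; (inj₂ (inj₂ w∈k₂)) → case only E₂ w∈k₂ of λ
                  { (inj₁ refl) → b∉e (right Ee) ; (inj₂ refl) → w∉f c∈f } } }
        where
        open Quad Q
        via : k₁ ~ f → c ∈ᵥ f
        via k₁~f = Sum.[ ⊥-elim ∘ a∉f , id ]′ (~-ends E₁ (~-sym k₁~f))
        via-f : k₂ ~ f → ¬ c ∈ᵥ f → ⊥
        via-f k₂~f c∉f = Sum.[ b∉f , c∉f ]′ (~-ends E₂ (~-sym k₂~f))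

    -- Quads, by the edges present between `a`, `w` and `y`, `z`.

    module QuadSolution {g a v} (Eg : Ends′ g v a) (g∈ : g ∈ E) where

      module Cross {w y z} (Q : Quad g a w y z) where

        open Quad Q

        a≢y : a ≢ y
        a≢y refl = a∉f (left Ef)
        a≢z : a ≢ z
        a≢z refl = a∉f (right Ef)
        w≢y : w ≢ y
        w≢y refl = w∉f (left Ef)
        w≢z : w ≢ z
        w≢z refl = w∉f (right Ef)

        pendant : ¬ Edge′ w y → ¬ Edge′ w z → Solution E
        pendant wy∉ wz∉ = Sum.[ id , isolated ]′ (cap f∈ Ef a∉f (λ x∈ x~f →
            Sum.map₂ Sum.[ id , (λ w∈x → ⊥-elim (apart x∈ w∈x x~f)) ]′ (at-f x∈ x~f)))
          where
          apart : ∀ {x} → x ∈ E → w ∈ᵥ x → x ≁ f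
          apart {x} x∈ w∈x x~f = case ~-ends Ef x~f of λ
            { (inj₁ y∈x) → wy∉ (x , x∈ , w∈x , y∈x) ; (inj₂ z∈x) → wz∉ (x , x∈ , w∈x , z∈x) }
          isolated : (∀ {x} → x ∈ E → x ~ f → x ≡ f) → Solution E
          isolated alone = leg (deg2 e∈ g∈ Ee (flip-ends Eg) (λ { refl → w∉g (left Eg) }) (λ x∈ a∈x → case at-a x∈ a∈x of λ
              { (inj₁ eq) → inj₂ eq ; (inj₂ (inj₁ eq)) → inj₁ eq
              ; (inj₂ (inj₂ x~f)) → ⊥-elim (a∉f (subst (a ∈ᵥ_) (alone x∈ x~f) a∈x)) }))
            (λ x∈ w∈x → Sum.[ id , ⊥-elim ∘ apart x∈ w∈x ]′ (at-w x∈ w∈x))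

        -- The degree of `w` is 2. An edge `ay` completes a triangle at `w`; otherwise `az`
        -- completes a 4-cycle, with `z` as second common neighbour of `a` and `y`; without both,
        -- `z` is a leaf and `y` has degree 2.
        one : Edge′ w y → ¬ Edge′ w z → Solution E
        one (k , k∈ , w∈k , y∈k) wz∉ = go (edge? a y)
          where
          Ek : Ends′ k w y
          Ek = ends-at w≢y w∈k y∈k
          Δw : Deg2 w a y
          Δw = deg2 e∈ k∈ (flip-ends Ee) Ek a≢y (λ {x} x∈ w∈x → Sum.map₂ (λ x~f → case ~-ends Ef x~f of λ
            { (inj₁ y∈x) → simple w≢y w∈x y∈x w∈k y∈k ; (inj₂ z∈x) → ⊥-elim (wz∉ (x , x∈ , w∈x , z∈x)) }) (at-w x∈ w∈x))
          Δy : ¬ Edge′ a y → Deg2 y z w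
          Δy ay∉ = deg2 f∈ k∈ Ef (flip-ends Ek) (≢-sym w≢z) (λ {x} x∈ y∈x → case at-f x∈ (y , y∈x , left Ef) of λ
            { (inj₁ eq) → inj₁ eq
            ; (inj₂ (inj₁ a∈x)) → ⊥-elim (ay∉ (x , x∈ , a∈x , y∈x))
            ; (inj₂ (inj₂ w∈x)) → inj₂ (simple w≢y w∈x y∈x w∈k y∈k) })
          far : ¬ Edge′ a y → Dec (Edge′ a z) → Solution E
          far ay∉ (yes (j , j∈ , a∈j , z∈j)) =
            square Δw ay∉ j∈ (ends-at a≢z a∈j z∈j) f∈ Ef (≢-sym w≢z)
          far ay∉ (no az∉) = leg (Δy ay∉) (λ {x} x∈ z∈x → case at-f x∈ (z , z∈x , right Ef) of λ
            { (inj₁ eq) → eq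
            ; (inj₂ (inj₁ a∈x)) → ⊥-elim (az∉ (x , x∈ , a∈x , z∈x))
            ; (inj₂ (inj₂ w∈x)) → ⊥-elim (wz∉ (x , x∈ , w∈x , z∈x)) })
          go : Dec (Edge′ a y) → Solution E
          go (yes (j , j∈ , a∈j , y∈j)) = triangle Δw j∈ (ends-at a≢y a∈j y∈j)
          go (no ay∉) = far ay∉ (edge? a z)

        corner : Edge′ w y → Edge′ w z → ¬ Edge′ a y → Solution E
        corner (k , k∈ , w∈k , y∈k) (j , j∈ , w∈j , z∈j) ay∉ =
          triangle (deg2 f∈ k∈ Ef (flip-ends (ends-at w≢y w∈k y∈k)) (≢-sym w≢z) (λ {x} x∈ y∈x →
              case at-f x∈ (y , y∈x , left Ef) of λ
                { (inj₁ eq) → inj₁ eq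
                ; (inj₂ (inj₁ a∈x)) → ⊥-elim (ay∉ (x , x∈ , a∈x , y∈x))
                ; (inj₂ (inj₂ w∈x)) → inj₂ (simple w≢y w∈x y∈x w∈k y∈k) }))
            j∈ (flip-ends (ends-at w≢z w∈j z∈j))

        complete : Edge′ w y → Edge′ w z → Edge′ a y → Edge′ a z → Solution E
        complete (k , k∈ , w∈k , y∈k) (j , j∈ , w∈j , z∈j) (i , i∈ , a∈i , y∈i) (l , l∈ , a∈l , z∈l) =
          K₄.solution record
            { Epq = Ee ; Epr = ends-at a≢y a∈i y∈i ; Eps = ends-at a≢z a∈l z∈l
            ; Eqr = ends-at w≢y w∈k y∈k ; Eqs = ends-at w≢z w∈j z∈j ; Ers = Ef
            ; star∈ = e∈ ∷ i∈ ∷ l∈ ∷ [] ; sides∈ = k∈ ∷ j∈ ∷ f∈ ∷ [] }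

      quad : ∀ {w y z} → Quad g a w y z → Solution E
      quad {w} {y} {z} Q with edge? w y | edge? w z | edge? a y | edge? a z
      ... | no wy∉ | no wz∉ | _ | _ = Cross.pendant Q wy∉ wz∉
      ... | yes wy | no wz∉ | _ | _ = Cross.one Q wy wz∉
      ... | no wy∉ | yes wz | _ | _ = Cross.one (flip-quad Q) wz wy∉
      ... | yes wy | yes wz | no ay∉ | _ = Cross.corner Q wy wz ay∉
      ... | yes wy | yes wz | yes ay | no az∉ = Cross.corner (flip-quad Q) wz wy az∉
      ... | yes wy | yes wz | yes ay | yes az = Cross.complete Q wy wz ay az

    deg2-solution : ∀ {v a b} → Deg2 v a b → Solution E
    deg2-solution {v} {a} {b} Δ with edge? a b
    ... | yes (m , m∈ , a∈m , b∈m) = triangle Δ m∈ (ends-at (Deg2.a≢b Δ) a∈m b∈m)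
    ... | no ab∉ = Open₂-solution.solution Δ ab∉
      (λ Q _ _ → QuadSolution.quad Eg g∈ Q)
      (λ Q _ _ → QuadSolution.quad Eh h∈ Q)
      where open Deg2 Δ

    -- Vertices of degree 3.

    record Deg3 (v a b c : V) : Set where
      field
        {g h k} : A
        g∈   : g ∈ E
        h∈   : h ∈ E
        k∈   : k ∈ E
        Eg   : Ends′ g v a
        Eh   : Ends′ h v b
        Ek   : Ends′ k v c
        a≢b  : a ≢ b
        a≢c  : a ≢ c
        b≢c  : b ≢ c
        at-v : ∀ {x} → x ∈ E → v ∈ᵥ x → x ≡ g ⊎ x ≡ h ⊎ x ≡ k

      h~g : h ~ g
      h~g = v , left Eh , left Eg

      g≢h : g ≢ h
      g≢h = ends≢ Eg (right Eh) (≢-sym (distinct Eh)) (≢-sym a≢b)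

    flip₃ : ∀ {v a b c} → Deg3 v a b c → Deg3 v b a c
    flip₃ Δ = record { g∈ = h∈ ; h∈ = g∈ ; k∈ = k∈ ; Eg = Eh ; Eh = Eg ; Ek = Ek
      ; a≢b = ≢-sym a≢b ; a≢c = b≢c ; b≢c = a≢c
      ; at-v = λ x∈ v∈ → Sum.[ inj₂ ∘ inj₁ , Sum.[ inj₁ , inj₂ ∘ inj₂ ]′ ]′ (at-v x∈ v∈) }
      where open Deg3 Δ

    turn₃ : ∀ {v a b c} → Deg3 v a b c → Deg3 v c b a
    turn₃ Δ = record { g∈ = k∈ ; h∈ = h∈ ; k∈ = g∈ ; Eg = Ek ; Eh = Eh ; Ek = Eg
      ; a≢b = ≢-sym b≢c ; a≢c = ≢-sym a≢c ; b≢c = ≢-sym a≢b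
      ; at-v = λ x∈ v∈ → Sum.[ inj₂ ∘ inj₂ , Sum.[ inj₂ ∘ inj₁ , inj₁ ]′ ]′ (at-v x∈ v∈) }
      where open Deg3 Δ

    Only : V → A → Set
    Only c k = ∀ {x} → x ∈ E → c ∈ᵥ x → x ≡ k

    Other : V → A → Set
    Other a g = Σ[ x ∈ A ] (x ∈ E × a ∈ᵥ x × x ≢ g)

    -- Only `g` and `h` are deleted. The remaining edge `k` is then the one surviving edge at `v`,
    -- and it is the additional candidate for colliding with `g` or for entering a new pair.
    module Open₃ {v a b c} (Δ : Deg3 v a b c) (ab∉ : ¬ Edge′ a b)
      (P : Pruned (Deg3.g Δ) (Deg3.h Δ)) where

      open Deg3 Δ
      open Pruned P

      k∈′ : k ∈ E′
      k∈′ = case split₂ k∈ of λ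
        { (inj₁ refl) → ⊥-elim (Sum.[ distinct Ek ∘ sym , a≢c ∘ sym ]′ (only Eg (right Ek)))
        ; (inj₂ (inj₁ refl)) → ⊥-elim (Sum.[ distinct Ek ∘ sym , b≢c ∘ sym ]′ (only Eh (right Ek)))
        ; (inj₂ (inj₂ k∈′)) → k∈′ }

      v→k : ∀ {x} → x ∈ E′ → v ∈ᵥ x → x ≡ k
      v→k x∈ v∈x = Sum.[ ⊥-elim ∘ ≢g x∈ , Sum.[ ⊥-elim ∘ ≢h x∈ , id ]′ ]′ (at-v (E′⊆E x∈) v∈x)

      b∉g : ¬ b ∈ᵥ g
      b∉g b∈g = Sum.[ distinct Eh ∘ sym , a≢b ∘ sym ]′ (only Eg b∈g)

      b∉k : ¬ b ∈ᵥ k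
      b∉k b∈k = Sum.[ distinct Eh ∘ sym , b≢c ]′ (only Ek b∈k)

      c∉g : ¬ c ∈ᵥ g
      c∉g c∈g = Sum.[ distinct Ek ∘ sym , a≢c ∘ sym ]′ (only Eg c∈g)

      c∉h : ¬ c ∈ᵥ h
      c∉h c∈h = Sum.[ distinct Ek ∘ sym , b≢c ∘ sym ]′ (only Eh c∈h)

      in-E′ : ∀ {x} → x ∈ E → x ≢ g → x ≢ h → x ∈ E′
      in-E′ x∈ x≢g x≢h = Sum.[ ⊥-elim ∘ x≢g , Sum.[ ⊥-elim ∘ x≢h , id ]′ ]′ (split₂ x∈)

      module Coll (C : Collision P) where

        open Collision C

        no-b : f ≢ k → b ∈ᵥ f → ∀ {d} → d ∈ D′ → ¬ b ∈ᵥ d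
        no-b f≢k b∈f {d} d∈ b∈d = case ~-ends Eg (proj₂ (same d∈) (b , b∈d , b∈f)) of λ
          { (inj₁ v∈d) → b∉k (subst (b ∈ᵥ_) (v→k (D′⊆E′ d∈) v∈d) b∈d)
          ; (inj₂ a∈d) → ab∉ (d , E′⊆E (D′⊆E′ d∈) , a∈d , b∈d) }

        at-b : f ≢ k → b ∈ᵥ f
        at-b f≢k = case ~-ends Eh (~-sym h~f) of λ
          { (inj₁ v∈f) → ⊥-elim (f≢k (v→k f∈ v∈f)) ; (inj₂ b∈f) → b∈f }

        -- k is then undominated, so c is a pendant vertex.
        stub : f ≡ k → (∀ {d} → d ∈ D′ → ¬ a ∈ᵥ d) → Only c k
        stub refl no-a {x} x∈ c∈x with x ≟ f
        ... | yes eq = eq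
        ... | no x≢f = ⊥-elim (undominated→isolated f∈ f∉ undominated
                (in-E′ x∈ (λ { refl → c∉g c∈x }) (λ { refl → c∉h c∈x })) x≢f (c , c∈x , right Ek))
          where
          undominated : ∀ {d} → d ∈ D′ → d ≁ f
          undominated d∈ d~f = case ~-ends Eg (proj₂ (same d∈) d~f) of λ
            { (inj₁ v∈d) → f∉ (subst (_∈ D′) (v→k (D′⊆E′ d∈) v∈d) d∈) ; (inj₂ a∈d) → no-a d∈ a∈d }

        other-a : f ≡ k → Only c k → Other a g
        other-a refl only-k = case split₂ x∈ of λ
          { (inj₁ eq) → ⊥-elim (x≢g eq)
          ; (inj₂ (inj₁ refl)) → case apart of λ
              { (inj₁ (_ , h≁k)) → ⊥-elim (h≁k h~f) ; (inj₂ (_ , h≁g)) → ⊥-elim (h≁g h~g) }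
          ; (inj₂ (inj₂ x∈′)) → case apart of λ
              { (inj₁ (x~g , _)) → case ~-ends Eg x~g of λ
                  { (inj₁ v∈x) → ⊥-elim (x≢f (v→k x∈′ v∈x)) ; (inj₂ a∈x) → x , x∈ , a∈x , x≢g }
              ; (inj₂ (x~k , _)) → case ~-ends Ek x~k of λ
                  { (inj₁ v∈x) → ⊥-elim (x≢f (v→k x∈′ v∈x)) ; (inj₂ c∈x) → ⊥-elim (x≢f (only-k x∈ c∈x)) } } }

      module Pair (N : NewPair P) where

        open NewPair N

        a∉f : ¬ a ∈ᵥ f
        a∉f a∈f = g≁f (a , right Eg , a∈f)

        v∉f : ¬ v ∈ᵥ f
        v∉f v∈f = g≁f (v , left Eg , v∈f)

        away : ¬ v ∈ᵥ e → Solution E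
        away v∉e with ends (Fresh.a∈e Eg Eh g∈ ab∉ P N v∉e) | shape f
        ... | w , Ee | inj₁ empty = Fresh.hanging Eg Eh g∈ ab∉ P N v∉e Ee empty
        ... | w , Ee | inj₂ (y , z , Ef) = go (w ∈ᵥ? f)
          where
          open Fresh Eg Eh g∈ ab∉ P N v∉e using (shared; quad)
          f∈E = E′⊆E (~→∈ P (y , left Ef , left Ef) f∈)
          go : Dec (w ∈ᵥ f) → Solution E
          go (no w∉f) = QuadSolution.quad Eg g∈ (quad Ee f∈E Ef w∉f)
          go (yes w∈f) = shared Ee f∈E (proj₂ (ends w∈f)) (λ Δa _ → deg2-solution Δa)

        module _ (e≡k : e ≡ k) {u} (f∈E : f ∈ E) (Ef : Ends′ f b u) where

          touches : ∀ {x} → x ∈ E → x ≢ g → x ≢ h → x ≢ k → x ≢ f → (x ~ k → x ~ f) × (x ~ f → x ~ k)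
          touches {x} x∈ x≢g x≢h x≢k x≢f = subst (λ z → (x ~ z → x ~ f) × (x ~ f → x ~ z)) e≡k
            (twin (in-E′ x∈ x≢g x≢h) (λ x≡e → x≢k (trans x≡e e≡k)) x≢f)

          at-b : ∀ {x} → x ∈ E → b ∈ᵥ x → x ≡ f ⊎ x ≡ h ⊎ c ∈ᵥ x
          at-b {x} x∈ b∈x with x ≟ f | x ≟ h
          ... | yes eq | _ = inj₁ eq
          ... | no _ | yes eq = inj₂ (inj₁ eq)
          ... | no x≢f | no x≢h = inj₂ (inj₂ (case ~-ends Ek (proj₂ (touches x∈ (λ { refl → b∉g b∈x }) x≢h
                (λ { refl → b∉k b∈x }) x≢f) (b , b∈x , left Ef)) of λ
                  { (inj₂ c∈x) → c∈x
                  ; (inj₁ v∈x) → ⊥-elim (x≢h (simple (distinct Eh) v∈x b∈x (left Eh) (right Eh))) }))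

          u≢v : u ≢ v
          u≢v refl = v∉f (right Ef)

          a≢u : a ≢ u
          a≢u refl = a∉f (right Ef)

          at-u : u ≢ c → ∀ {x} → x ∈ E → u ∈ᵥ x → x ≡ f ⊎ c ∈ᵥ x
          at-u u≢c {x} x∈ u∈x with x ≟ f
          ... | yes eq = inj₁ eq
          ... | no x≢f = inj₂ (case ~-ends Ek (proj₂ (touches x∈
                (λ { refl → Sum.[ u≢v , a≢u ∘ sym ]′ (only Eg u∈x) })
                (λ { refl → Sum.[ u≢v , distinct Ef ∘ sym ]′ (only Eh u∈x) })
                (λ { refl → Sum.[ u≢v , u≢c ]′ (only Ek u∈x) }) x≢f) (u , u∈x , right Ef)) of λ
                  { (inj₂ c∈x) → c∈x
                  ; (inj₁ v∈x) → case at-v x∈ v∈x of λ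
                      { (inj₁ refl) → ⊥-elim (Sum.[ u≢v , a≢u ∘ sym ]′ (only Eg u∈x))
                      ; (inj₂ (inj₁ refl)) → ⊥-elim (Sum.[ u≢v , distinct Ef ∘ sym ]′ (only Eh u∈x))
                      ; (inj₂ (inj₂ refl)) → right Ek } })

          at-c : u ≢ c → ∀ {x} → x ∈ E → c ∈ᵥ x → x ≡ k ⊎ b ∈ᵥ x ⊎ u ∈ᵥ x
          at-c u≢c {x} x∈ c∈x with x ≟ k
          ... | yes eq = inj₁ eq
          ... | no x≢k = inj₂ (~-ends Ef (proj₁ (touches x∈ (λ { refl → c∉g c∈x }) (λ { refl → c∉h c∈x }) x≢k
                (λ { refl → Sum.[ b≢c ∘ sym , u≢c ∘ sym ]′ (only Ef c∈x) })) (c , c∈x , right Ek)))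

          -- The edges `k`, which is `vc`, and `f`, which is `bu`, are twins up to `g` and `h`. For
          -- `u ≢ c`, further edges at `b`, `u` or `c` can therefore only be `bc` and `uc`.
          -- Whichever are present, one of `b`, `u`, `c` has degree 2.
          close : Dec (u ≡ c) → Solution E
          close (yes refl) = deg2-solution (deg2 f∈E h∈ Ef (flip-ends Eh) u≢v (λ x∈ b∈x →
            Sum.[ inj₁ , Sum.[ inj₂ , (λ c∈x → inj₁ (simple b≢c b∈x c∈x (left Ef) (right Ef))) ]′ ]′ (at-b x∈ b∈x)))
          close (no u≢c) = go (edge? u c) (edge? b c)
            where
            go : Dec (Edge′ u c) → Dec (Edge′ b c) → Solution E
            go (yes (j , j∈ , u∈j , c∈j)) _ = deg2-solution (deg2 f∈E j∈ (flip-ends Ef) (ends-at u≢c u∈j c∈j) b≢c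
              (λ x∈ u∈x → Sum.map₂ (λ c∈x → simple u≢c u∈x c∈x u∈j c∈j) (at-u u≢c x∈ u∈x)))
            go (no uc∉) (yes (j , j∈ , b∈j , c∈j)) = deg2-solution (deg2 k∈ j∈ (flip-ends Ek)
              (ends-at (≢-sym b≢c) c∈j b∈j) (distinct Eh)
              (λ {x} x∈ c∈x → Sum.map₂ Sum.[ (λ b∈x → simple b≢c b∈x c∈x b∈j c∈j)
                                           , (λ u∈x → ⊥-elim (uc∉ (x , x∈ , u∈x , c∈x))) ]′ (at-c u≢c x∈ c∈x)))
            go (no uc∉) (no bc∉) = deg2-solution (deg2 f∈E h∈ Ef (flip-ends Eh) u≢v
              (λ {x} x∈ b∈x → Sum.map₂ Sum.[ id , (λ c∈x → ⊥-elim (bc∉ (x , x∈ , b∈x , c∈x))) ]′ (at-b x∈ b∈x)))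

        solution : Solution E
        solution with v ∈ᵥ? e
        ... | no v∉e = away v∉e
        ... | yes v∈e = close e≡k f∈E (proj₂ (ends b∈f)) (_ ≟ᵥ c)
          where
          e≡k = v→k e∈ v∈e
          h~f : h ~ f
          h~f = proj₁ h~ (v , left Eh , v∈e)
          f∈E = E′⊆E (~→∈ P h~f f∈)
          b∈f : b ∈ᵥ f
          b∈f = Sum.[ ⊥-elim ∘ v∉f , id ]′ (~-ends Eh (~-sym h~f))

    module Deg3-solution {v a b c} (Δ : Deg3 v a b c) (ab∉ : ¬ Edge′ a b) where

      open Deg3 Δ

      P : Pruned g h
      P = prune g∈ h∈ g≢h

      open Pruned P

      ba∉ : ¬ Edge′ b a
      ba∉ (x , x∈ , b∈x , a∈x) = ab∉ (x , x∈ , a∈x , b∈x)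

      module L = Open₃ Δ ab∉ P
      module R = Open₃ (flip₃ Δ) ba∉ (flip-pruned P)

      -- The one outcome that the choice between `g` and `h` leaves open; `retry` resolves it with
      -- another pair of edges at `v`.
      Pendant : Set
      Pendant = Only c k × (Other a g ⊎ Other b h)

      -- No chosen edge lies at `a` or `b`, so `f` and `f′` have at most `k` in their traces. If `k`
      -- is not chosen, `f` is isolated in `E′` and `b` has degree 2. If it is, then `f` is `bc`,
      -- `f′` is `ac`, and their twinship leaves no further edge at `a`, which has degree 2.
      module Both (C : Collision P) (C′ : Collision (flip-pruned P))
        (f≢k : Collision.f C ≢ k) (f′≢k : Collision.f C′ ≢ k) where

        module C = Collision C
        module C′ = Collision C′

        b∈f : b ∈ᵥ C.f
        b∈f = L.Coll.at-b C f≢k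
        a∈f′ : a ∈ᵥ C′.f
        a∈f′ = R.Coll.at-b C′ f′≢k
        a∉f : ¬ a ∈ᵥ C.f
        a∉f a∈f = ab∉ (C.f , E′⊆E C.f∈ , a∈f , b∈f)

        f→k : ∀ {d} → d ∈ D′ → d ~ C.f → d ≡ k
        f→k d∈ d~f = case ~-ends Eg (proj₂ (C.same d∈) d~f) of λ
          { (inj₁ v∈d) → L.v→k (D′⊆E′ d∈) v∈d ; (inj₂ a∈d) → ⊥-elim (R.Coll.no-b C′ f′≢k a∈f′ d∈ a∈d) }

        f′→k : ∀ {d} → d ∈ D′ → d ~ C′.f → d ≡ k
        f′→k d∈ d~f = case ~-ends Eh (proj₂ (C′.same d∈) d~f) of λ
          { (inj₁ v∈d) → L.v→k (D′⊆E′ d∈) v∈d ; (inj₂ b∈d) → ⊥-elim (L.Coll.no-b C f≢k b∈f d∈ b∈d) }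

        v∉f : ¬ v ∈ᵥ C.f
        v∉f v∈f = f≢k (L.v→k C.f∈ v∈f)

        solution : Solution E
        solution with k ∈? D′
        ... | no k∉D = deg2-solution (deg2 (E′⊆E C.f∈) h∈ Ef (flip-ends Eh)
                (λ eq → v∉f (subst (_∈ᵥ C.f) eq (right Ef))) at-b)
          where
          Ef = proj₂ (ends b∈f)
          at-b : ∀ {x} → x ∈ E → b ∈ᵥ x → x ≡ C.f ⊎ x ≡ h
          at-b {x} x∈ b∈x with x ≟ C.f | x ≟ h
          ... | yes eq | _ = inj₁ eq
          ... | no _ | yes eq = inj₂ eq
          ... | no x≢f | no x≢h = ⊥-elim (undominated→isolated C.f∈ C.f∉
                  (λ d∈ d~f → k∉D (subst (_∈ D′) (f→k d∈ d~f) d∈))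
                  (L.in-E′ x∈ (λ { refl → L.b∉g b∈x }) x≢h) x≢f (b , b∈x , b∈f))
        ... | yes k∈D = deg2-solution (deg2 (E′⊆E C′.f∈) g∈ Ef′ (flip-ends Eg) (distinct Ek ∘ sym) at-a)
          where
          k~f : k ~ C.f
          k~f = proj₁ (C.same k∈D) (v , left Ek , left Eg)
          k~f′ : k ~ C′.f
          k~f′ = proj₁ (C′.same k∈D) (v , left Ek , left Eh)
          c∈f : c ∈ᵥ C.f
          c∈f = Sum.[ ⊥-elim ∘ v∉f , id ]′ (~-ends Ek (~-sym k~f))
          Ef′ : Ends′ C′.f a c
          Ef′ = ends-at a≢c a∈f′ (Sum.[ (λ v∈f′ → ⊥-elim (f′≢k (L.v→k C′.f∈ v∈f′))) , id ]′ (~-ends Ek (~-sym k~f′)))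
          at-a : ∀ {x} → x ∈ E → a ∈ᵥ x → x ≡ C′.f ⊎ x ≡ g
          at-a {x} x∈ a∈x with x ≟ C′.f | x ≟ g
          ... | yes eq | _ = inj₁ eq
          ... | no _ | yes eq = inj₂ eq
          ... | no x≢f′ | no x≢g = ⊥-elim (case ~-ends (ends-at b≢c b∈f c∈f) x~f of λ
                  { (inj₁ b∈x) → ab∉ (x , x∈ , a∈x , b∈x)
                  ; (inj₂ c∈x) → x≢f′ (simple a≢c a∈x c∈x a∈f′ (right Ef′)) })
            where
            x~f : x ~ C.f
            x~f = proj₁ (same→twin (there C′.f∈) (there C.f∈) C′.f∉ C.f∉
              (λ d∈ → (λ d~f′ → case f′→k d∈ d~f′ of λ { refl → k~f }) , (λ d~f → case f→k d∈ d~f of λ { refl → k~f′ }))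
              (L.in-E′ x∈ x≢g (λ { refl → R.b∉g a∈x })) x≢f′ (λ { refl → a∉f a∈x })) (a , a∈x , a∈f′)

      collisions : Collision P → Collision (flip-pruned P) → Solution E ⊎ Pendant
      collisions C C′ with Collision.f C ≟ k | Collision.f C′ ≟ k
      ... | yes eq | yes eq′ = inj₂ (only-k , inj₁ (L.Coll.other-a C eq only-k))
        where
        module C = Collision C
        module C′ = Collision C′
        no-a : ∀ {d} → d ∈ D′ → ¬ a ∈ᵥ d
        no-a {d} d∈ a∈d = case ~-ends Eh (proj₂ (C′.same d∈) (subst (d ~_) (trans eq (sym eq′))
                                (proj₁ (C.same d∈) (a , a∈d , right Eg)))) of λ
          { (inj₁ v∈d) → C.f∉ (subst (_∈ D′) (trans (L.v→k (D′⊆E′ d∈) v∈d) (sym eq)) d∈)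
          ; (inj₂ b∈d) → ab∉ (d , E′⊆E (D′⊆E′ d∈) , a∈d , b∈d) }
        only-k : Only c k
        only-k = L.Coll.stub C eq no-a
      ... | yes eq | no f′≢k = inj₂ (only-k , inj₁ (L.Coll.other-a C eq only-k))
        where
        only-k : Only c k
        only-k = L.Coll.stub C eq (R.Coll.no-b C′ f′≢k (R.Coll.at-b C′ f′≢k))
      ... | no f≢k | yes eq′ = inj₂ (only-k , inj₂ (R.Coll.other-a C′ eq′ only-k))
        where
        only-k : Only c k
        only-k = R.Coll.stub C′ eq′ (L.Coll.no-b C f≢k (L.Coll.at-b C f≢k))
      ... | no f≢k | no f′≢k = inj₁ (Both.solution C C′ f≢k f′≢k)

      attempt : Solution E ⊎ Pendant
      attempt with good-or-bad E (h ∷ D′) | good-or-bad E (g ∷ D′)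
      ... | inj₁ good | _ = inj₁ (add-h good)
      ... | inj₂ _ | inj₁ good = inj₁ (Pruned.add-h (flip-pruned P) good)
      ... | inj₂ bad | inj₂ bad′ with failure P h~g bad | failure (flip-pruned P) (~-sym h~g) bad′
      ...   | inj₁ C | inj₁ C′ = collisions C C′
      ...   | inj₂ N | _ = inj₁ (L.Pair.solution N)
      ...   | inj₁ _ | inj₂ N = inj₁ (R.Pair.solution N)

    -- The leaf `c` is not adjacent to `b`, so `k` and `h` can be deleted instead. This attempt
    -- could remain open only if `a` were a leaf, which the edge `x` excludes.
    retry : ∀ {v a b c} (Δ : Deg3 v a b c) → Only c (Deg3.k Δ) → Other a (Deg3.g Δ) → Solution E
    retry {b = b} {c} Δ only-k (x , x∈ , a∈x , x≢g) =
      Sum.[ id , (λ { (only-g , _) → ⊥-elim (x≢g (only-g x∈ a∈x)) }) ]′ (Deg3-solution.attempt (turn₃ Δ) cb∉)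
      where
      open Deg3 Δ
      cb∉ : ¬ Edge′ c b
      cb∉ (y , y∈ , c∈y , b∈y) with only-k y∈ c∈y
      ... | refl = Sum.[ distinct Eh ∘ sym , b≢c ]′ (only Ek b∈y)

    nonadjacent : ∀ {v a b c} → Deg3 v a b c → ¬ Edge′ a b → Solution E
    nonadjacent Δ ab∉ = Sum.[ id , (λ { (only-k , other) → Sum.[ retry Δ only-k , retry (flip₃ Δ) only-k ]′ other }) ]′
      (Deg3-solution.attempt Δ ab∉)

    edge-sym : ∀ {p q} → Edge′ p q → Edge′ q p
    edge-sym (x , x∈ , p∈x , q∈x) = x , x∈ , q∈x , p∈x

    deg3-solution : ∀ {v a b c} → Deg3 v a b c → Solution E
    deg3-solution {v} {a} {b} {c} Δ with edge? a b | edge? b c | edge? a c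
    ... | no ab∉ | _ | _ = nonadjacent Δ ab∉
    ... | yes _ | no bc∉ | _ = nonadjacent (turn₃ Δ) (bc∉ ∘ edge-sym)
    ... | yes _ | yes _ | no ac∉ = nonadjacent (turn₃ (flip₃ Δ)) (ac∉ ∘ edge-sym)
    ... | yes (x , x∈ , a∈x , b∈x) | yes (y , y∈ , b∈y , c∈y) | yes (z , z∈ , a∈z , c∈z) = K₄.solution record
          { Epq = Eg ; Epr = Eh ; Eps = Ek
          ; Eqr = ends-at a≢b a∈x b∈x ; Eqs = ends-at a≢c a∈z c∈z ; Ers = ends-at b≢c b∈y c∈y
          ; star∈ = g∈ ∷ h∈ ∷ k∈ ∷ [] ; sides∈ = x∈ ∷ z∈ ∷ y∈ ∷ [] }
      where open Deg3 Δ

    -- All degrees are 0, 1 or at least 4.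

    Leaf : V → Set
    Leaf v = ∀ {x y} → x ∈ E → y ∈ E → v ∈ᵥ x → v ∈ᵥ y → x ≡ y

    -- What is retained of the orientation: a vertex owns edges of which it is the tail.
    record Owners : Set₁ where
      field
        D        : List A
        D⊆E      : ∀ {d} → d ∈ D → d ∈ E
        D-unique : Unique D
        small    : 2 * length D ≤ length E
        Owns     : V → A → Set
        owner    : ∀ {v w d} → Owns v d → Owns w d → v ≡ w
        own      : ∀ v → Leaf v ⊎ Σ[ d ∈ A ] (d ∈ D × v ∈ᵥ d × Owns v d)

    -- Since distinct vertices own distinct edges, a bad pair e, f closes up to a K₄.
    module Owned (O : Owners) where

      open Owners O

      owned : ∀ {v x y} → x ∈ E → y ∈ E → v ∈ᵥ x → v ∈ᵥ y → x ≢ y → Σ[ d ∈ A ] (d ∈ D × v ∈ᵥ d × Owns v d)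
      owned {v} x∈ y∈ v∈x v∈y x≢y = Sum.[ (λ leaf → ⊥-elim (x≢y (leaf x∈ y∈ v∈x v∈y))) , id ]′ (own v)

      -- There is only one edge `pq`, and it has only one owner.
      twice : ∀ {p q d d′} → p ≢ q → Owns p d → p ∈ᵥ d → q ∈ᵥ d → Owns q d′ → ¬ (q ∈ᵥ d′ × p ∈ᵥ d′)
      twice p≢q o p∈d q∈d o′ (q∈d′ , p∈d′) with simple p≢q p∈d q∈d p∈d′ q∈d′
      ... | refl = p≢q (owner o o′)

      module _ {e f x p} (e∈ : e ∈ E) (f∈ : f ∈ null ∷ E) (e∉ : e ∉ D) (f∉ : f ∉ D) (same : Same D e f)
        (x∈ : x ∈ E) (x≢e : x ≢ e) (p∈x : p ∈ᵥ x) (p∈e : p ∈ᵥ e) (p∉f : ¬ p ∈ᵥ f) where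

        first : Σ[ d ∈ A ] (d ∈ D × p ∈ᵥ d × Owns p d)
        first = owned x∈ e∈ p∈x p∈e x≢e

        crossing : ∀ {d} → d ∈ D → p ∈ᵥ d → Σ[ u ∈ V ] (u ∈ᵥ d × u ∈ᵥ f)
        crossing d∈ p∈d = proj₁ (same d∈) (p , p∈d , p∈e)

        in-E : ∀ {u} → u ∈ᵥ f → f ∈ E
        in-E u∈f = case f∈ of λ { (here refl) → ⊥-elim (null-empty u∈f) ; (there f∈) → f∈ }

        D≢ : ∀ {d k} → d ∈ D → k ∉ D → d ≢ k
        D≢ d∈ k∉ refl = k∉ d∈

        -- Let `e` be `pq` and `f` be `ut`. A chosen edge touching one of them touches the other, so
        -- the edge owned by an end of one leads to an end of the other, and by `twice` it never
        -- leads back. The owned edges thus run from `p` to `u`, `q`, `t` and back to `p`, a 4-cycle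
        -- with diagonals `e` and `f`.
        solution : Solution E
        solution with first
        ... | d₁ , d₁∈ , p∈d₁ , o₁ with crossing d₁∈ p∈d₁
        ...   | u , u∈d₁ , u∈f with ends p∈e | ends u∈f
        ...     | q , Ee | t , Ef = go (q ∈ᵥ? f)
          where
          f∈E = in-E u∈f
          p≢u : p ≢ u
          p≢u refl = p∉f u∈f
          p≢t : p ≢ t
          p≢t refl = p∉f (right Ef)
          second : Σ[ d ∈ A ] (d ∈ D × u ∈ᵥ d × Owns u d)
          second = owned f∈E (D⊆E d₁∈) u∈f u∈d₁ (≢-sym (D≢ d₁∈ f∉))
          to-q : Σ[ d ∈ A ] (d ∈ D × u ∈ᵥ d × q ∈ᵥ d × Owns u d)
          to-q = case second of λ { (d₂ , d₂∈ , u∈d₂ , o₂) → case ~-ends Ee (proj₂ (same d₂∈) (u , u∈d₂ , u∈f)) of λ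
            { (inj₁ p∈d₂) → ⊥-elim (twice p≢u o₁ p∈d₁ u∈d₁ o₂ (u∈d₂ , p∈d₂))
            ; (inj₂ q∈d₂) → d₂ , d₂∈ , u∈d₂ , q∈d₂ , o₂ } }
          q≢u : q ≢ u
          q≢u refl = D≢ d₁∈ e∉ (simple (distinct Ee) p∈d₁ u∈d₁ p∈e (right Ee))
          go : Dec (q ∈ᵥ f) → Solution E
          go (yes q∈f) with to-q
          ... | d₂ , d₂∈ , u∈d₂ , q∈d₂ , _ = ⊥-elim (D≢ d₂∈ f∉ (simple q≢u q∈d₂ u∈d₂ q∈f u∈f))
          go (no q∉f) with to-q
          ... | d₂ , d₂∈ , u∈d₂ , q∈d₂ , o₂
            with owned e∈ (D⊆E d₂∈) (right Ee) q∈d₂ (≢-sym (D≢ d₂∈ e∉))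
          ...   | d₃ , d₃∈ , q∈d₃ , o₃ with ~-ends Ef (proj₁ (same d₃∈) (q , q∈d₃ , right Ee))
          ...     | inj₁ u∈d₃ = ⊥-elim (twice (≢-sym q≢u) o₂ u∈d₂ q∈d₂ o₃ (q∈d₃ , u∈d₃))
          ...     | inj₂ t∈d₃ with owned f∈E (D⊆E d₃∈) (right Ef) t∈d₃ (≢-sym (D≢ d₃∈ f∉))
          ...       | d₄ , d₄∈ , t∈d₄ , o₄ with ~-ends Ee (proj₂ (same d₄∈) (t , t∈d₄ , right Ef))
          ...         | inj₂ q∈d₄ = ⊥-elim (twice q≢t o₃ q∈d₃ t∈d₃ o₄ (t∈d₄ , q∈d₄))
            where
            q≢t : q ≢ t
            q≢t refl = q∉f (right Ef)
          ...         | inj₁ p∈d₄ = K₄.solution record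
            { Epq = Ee ; Epr = ends-at p≢u p∈d₁ u∈d₁ ; Eps = ends-at p≢t p∈d₄ t∈d₄
            ; Eqr = ends-at q≢u q∈d₂ u∈d₂ ; Eqs = ends-at q≢t q∈d₃ t∈d₃ ; Ers = Ef
            ; star∈ = e∈ ∷ D⊆E d₁∈ ∷ D⊆E d₄∈ ∷ [] ; sides∈ = D⊆E d₂∈ ∷ D⊆E d₃∈ ∷ f∈E ∷ [] }
            where
            q≢t : q ≢ t
            q≢t refl = q∉f (right Ef)

    owners-solution : Owners → Solution E
    owners-solution O with good-or-bad E (Owners.D O)
    ... | inj₁ good = mkSolution D D⊆E D-unique small good
      where open Owners O
    ... | inj₂ (mkBad e∈ f∈ e∉ f∉ same x∈ x≢e x≢f (p , p∈x , p∈e) x≁f) =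
      Owned.solution O (case e∈ of λ { (here refl) → ⊥-elim (null-empty p∈e) ; (there e∈) → e∈ })
        f∈ e∉ f∉ same x∈ x≢e p∈x p∈e (λ p∈f → x≁f (p , p∈x , p∈f))

    degree′ : V → ℕ
    degree′ v = length (filter (v ∈ᵥ?_) E)

    module Orient where

      open Orientation _≟ᵥ_

      Arc : A → V × V → Set
      Arc e (p , q) = Ends′ e p q

      arcs : ∀ {F} → All (λ e → ∃₂ (Ends′ e)) F → List (V × V)
      arcs []                 = []
      arcs ((p , q , _) ∷ es) = (p , q) ∷ arcs es

      oriented : ∀ {F M} (es : All (λ e → ∃₂ (Ends′ e)) F) → Pointwise Turn (arcs es) M → Pointwise Arc F M
      oriented []                  []          = []
      oriented ((p , q , Ee) ∷ es) (keep ∷ ts) = Ee ∷ oriented es ts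
      oriented ((p , q , Ee) ∷ es) (turn ∷ ts) = flip-ends Ee ∷ oriented es ts

      degree-split : ∀ {F M} → Pointwise Arc F M → ∀ v → length (filter (v ∈ᵥ?_) F) ≡ out v M + into v M
      degree-split [] v = refl
      degree-split {e ∷ F} {(p , q) ∷ M} (Ee ∷ es) v with v ∈ᵥ? e | p ≟ᵥ v | q ≟ᵥ v
      ... | _ | yes refl | yes refl = ⊥-elim (distinct Ee refl)
      ... | yes _ | yes refl | no _ = cong suc (degree-split es v)
      ... | yes _ | no _ | yes refl = trans (cong suc (degree-split es v)) (sym (+-suc _ _))
      ... | no _ | no _ | no _ = degree-split es v
      ... | yes v∈e | no p≢v | no q≢v = ⊥-elim (Sum.[ p≢v ∘ sym , q≢v ∘ sym ]′ (only Ee v∈e))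
      ... | no v∉e | yes refl | _ = ⊥-elim (v∉e (left Ee))
      ... | no v∉e | _ | yes refl = ⊥-elim (v∉e (right Ee))

      tails : ∀ {F M} → Pointwise Arc F M → List (A × V)
      tails [] = []
      tails {e ∷ _} {(p , _) ∷ _} (_ ∷ es) = (e , p) ∷ tails es

      length-tails : ∀ {F M} (es : Pointwise Arc F M) → length (tails es) ≡ length F
      length-tails [] = refl
      length-tails (_ ∷ es) = cong suc (length-tails es)

      tails-∈ : ∀ {F M e v} (es : Pointwise Arc F M) → (e , v) ∈ tails es → e ∈ F × v ∈ᵥ e
      tails-∈ (Ee ∷ _) (here refl) = here refl , left Ee
      tails-∈ (_ ∷ es) (there t∈) with tails-∈ es t∈
      ... | e∈ , v∈e = there e∈ , v∈e

      tails-functional : ∀ {F M e v w} (es : Pointwise Arc F M) → Unique F →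
        (e , v) ∈ tails es → (e , w) ∈ tails es → v ≡ w
      tails-functional (_ ∷ _) _ (here refl) (here refl) = refl
      tails-functional (_ ∷ es) (e∉ ∷ _) (here refl) (there t∈) = ⊥-elim (All.lookup e∉ (proj₁ (tails-∈ es t∈)) refl)
      tails-functional (_ ∷ es) (e∉ ∷ _) (there t∈) (here refl) = ⊥-elim (All.lookup e∉ (proj₁ (tails-∈ es t∈)) refl)
      tails-functional (_ ∷ es) (_ ∷ u) (there s∈) (there t∈) = tails-functional es u s∈ t∈

      at : V → List (A × V) → List (A × V)
      at v = filter (λ t → proj₂ t ≟ᵥ v)

      out-tails : ∀ {F M} (es : Pointwise Arc F M) v → out v M ≡ length (at v (tails es))
      out-tails [] v = refl
      out-tails {M = (p , _) ∷ _} (_ ∷ es) v with p ≟ᵥ v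
      ... | yes _ = cong suc (out-tails es v)
      ... | no _ = out-tails es v

      off : V → List (A × V) → List (A × V)
      off v = filter (λ t → ¬? (proj₂ t ≟ᵥ v))

      length-at-off : ∀ v T → length T ≡ length (at v T) + length (off v T)
      length-at-off v [] = refl
      length-at-off v ((e , p) ∷ T) with p ≟ᵥ v
      ... | yes _ = cong suc (length-at-off v T)
      ... | no _ = trans (cong suc (length-at-off v T)) (sym (+-suc _ _))

      at-off : ∀ {v w} T → v ≢ w → at w (off v T) ≡ at w T
      at-off [] v≢w = refl
      at-off {v} {w} ((e , p) ∷ T) v≢w with p ≟ᵥ v
      ... | yes refl = trans (at-off T v≢w) (sym (filter-reject (λ t → proj₂ t ≟ᵥ w) {xs = T} v≢w))
      ... | no _ with p ≟ᵥ w
      ...   | yes _ = cong (_ ∷_) (at-off T v≢w)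
      ...   | no _ = at-off T v≢w

      -- Arcs with different tails are different, so those with tail `v` can be set aside without
      -- affecting the counts at the other vertices.
      two-each : ∀ {L} T → Unique L → (∀ {v} → v ∈ L → 2 ≤ length (at v T)) → 2 * length L ≤ length T
      two-each T [] _ = z≤n
      two-each {v ∷ L} T (v∉ ∷ u) big = ≤-trans (≤-reflexive (*-distribˡ-+ 2 1 (length L)))
        (≤-trans (+-mono-≤ (big (here refl)) (two-each (off v T) u (λ w∈ →
            ≤-trans (big (there w∈)) (≤-reflexive (cong length (sym (at-off T (All.lookup v∉ w∈))))))))
          (≤-reflexive (sym (length-at-off v T))))

      map-unique : ∀ {f : V → A} {L} → (∀ {v w} → v ∈ L → w ∈ L → f v ≡ f w → v ≡ w) → Unique L → Unique (map f L)
      map-unique inj [] = []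
      map-unique {f} {v ∷ L} inj (v∉ ∷ u) =
        All.tabulate (λ d∈ fv≡d → case ∈-map⁻ f d∈ of λ
          { (w , w∈ , d≡) → All.lookup v∉ w∈ (inj (here refl) (there w∈) (trans fv≡d d≡)) })
        ∷ map-unique (λ v∈ w∈ → inj (there v∈) (there w∈)) u

      -- The value `null` is a mere default: only vertices with at least two outgoing arcs are
      -- considered.
      pick : V → List (A × V) → A
      pick v T with at v T
      ... | []          = null
      ... | (e , _) ∷ _ = e

      pick-∈ : ∀ v T → 2 ≤ length (at v T) → (pick v T , v) ∈ T
      pick-∈ v T big with at v T | (λ {t} → ∈-filter⁻ (λ t → proj₂ t ≟ᵥ v) {t} {T})
      ... | (e , p) ∷ _ | from with from (here refl)
      ...   | t∈ , refl = t∈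

      owners : (∀ v → degree′ v ≤ 1 ⊎ 4 ≤ degree′ v) → Owners
      owners sparse with orient _ (arcs (All.tabulate proper)) ≤-refl
      ... | M , ts , balanced = record
        { D = map (λ v → pick v T) heavy
        ; D⊆E = λ d∈ → case ∈-map⁻ _ d∈ of λ { (v , v∈ , refl) → proj₁ (tails-∈ es (heavy-∈ v∈)) }
        ; D-unique = map-unique (λ v∈ w∈ eq → tails-functional es E-unique (heavy-∈ v∈) (subst (λ e → (e , _) ∈ T) (sym eq) (heavy-∈ w∈)))
            (Unique.filter⁺ big? vertices-unique)
        ; small = ≤-trans (≤-reflexive (cong (2 *_) (length-map _ heavy)))
            (≤-trans (two-each T (Unique.filter⁺ big? vertices-unique) (proj₂ ∘ ∈-filter⁻ big? {xs = vertices}))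
                     (≤-reflexive (length-tails es)))
        ; Owns = λ v d → (d , v) ∈ T
        ; owner = tails-functional es E-unique
        ; own = own }
        where
        es : Pointwise Arc E M
        es = oriented (All.tabulate proper) ts
        T = tails es
        big? : ∀ v → Dec (2 ≤ length (at v T))
        big? v = 2 ≤? length (at v T)
        -- Selected by outdegree and not by degree: two outgoing edges are what pays for one chosen
        -- edge.
        heavy = filter big? vertices
        heavy-∈ : ∀ {v} → v ∈ heavy → (pick v T , v) ∈ T
        heavy-∈ {v} v∈ = pick-∈ v T (proj₂ (∈-filter⁻ big? {xs = vertices} v∈))
        own : ∀ v → Leaf v ⊎ Σ[ d ∈ A ] (d ∈ map (λ v → pick v T) heavy × v ∈ᵥ d × (d , v) ∈ T)
        own v with sparse v
        ... | inj₁ one = inj₁ (λ x∈ y∈ v∈x v∈y → short one (∈-filter⁺ (v ∈ᵥ?_) x∈ v∈x) (∈-filter⁺ (v ∈ᵥ?_) y∈ v∈y))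
          where
          short : ∀ {L : List A} {x y} → length L ≤ 1 → x ∈ L → y ∈ L → x ≡ y
          short {_ ∷ []} _ (here refl) (here refl) = refl
          short {_ ∷ _ ∷ _} (s≤s ())
        ... | inj₂ four = inj₂ (_ , ∈-map⁺ _ (∈-filter⁺ big? (∈-vertices v) two) , proj₂ (tails-∈ es (pick-∈ v T two)) , pick-∈ v T two)
          where
          -- Here degree 4 is needed: outdegree 1 would allow indegree at most 2, that is, degree at
          -- most 3.
          half : ∀ o i → 4 ≤ o + i → i ≤ suc o → 2 ≤ o
          half zero i four i≤ = case ≤-trans four i≤ of λ { (s≤s ()) }
          half (suc zero) i four i≤ = case ≤-trans four (s≤s i≤) of λ { (s≤s (s≤s (s≤s ()))) }
          half (suc (suc o)) i _ _ = s≤s (s≤s z≤n)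
          two : 2 ≤ length (at v T)
          two = ≤-trans (half _ _ (≤-trans four (≤-reflexive (degree-split es v))) (proj₂ (balanced v)))
                        (≤-reflexive (out-tails es v))

    -- The inductive step assembled, and the induction.

    ends-≢ : ∀ {g h v a b} → Ends′ g v a → Ends′ h v b → g ≢ h → a ≢ b
    ends-≢ Eg Eh g≢h refl = g≢h (simple (distinct Eg) (left Eg) (right Eg) (left Eh) (right Eh))

    thin-vertex : ∀ {v} F → Unique F → (∀ {x} → x ∈ F → x ∈ E × v ∈ᵥ x) → (∀ {x} → x ∈ E → v ∈ᵥ x → x ∈ F) →
      length F ≡ 2 ⊎ length F ≡ 3 → Solution E
    thin-vertex [] _ _ _ (inj₁ ())
    thin-vertex [] _ _ _ (inj₂ ())
    thin-vertex (_ ∷ []) _ _ _ (inj₁ ())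
    thin-vertex (_ ∷ []) _ _ _ (inj₂ ())
    thin-vertex (_ ∷ _ ∷ _ ∷ _ ∷ _) _ _ _ (inj₁ ())
    thin-vertex (_ ∷ _ ∷ _ ∷ _ ∷ _) _ _ _ (inj₂ ())
    thin-vertex (g ∷ h ∷ []) ((g≢h ∷ []) ∷ _) from to _ =
      deg2-solution (deg2 (proj₁ g∈) (proj₁ h∈) Eg Eh (ends-≢ Eg Eh g≢h)
        (λ x∈ v∈x → case to x∈ v∈x of λ { (here eq) → inj₁ eq ; (there (here eq)) → inj₂ eq }))
      where
      g∈ = from (here refl)
      h∈ = from (there (here refl))
      Eg = proj₂ (ends (proj₂ g∈))
      Eh = proj₂ (ends (proj₂ h∈))
    thin-vertex (g ∷ h ∷ k ∷ []) ((g≢h ∷ g≢k ∷ []) ∷ (h≢k ∷ []) ∷ _) from to _ = deg3-solution record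
      { g∈ = proj₁ g∈ ; h∈ = proj₁ h∈ ; k∈ = proj₁ k∈ ; Eg = Eg ; Eh = Eh ; Ek = Ek
      ; a≢b = ends-≢ Eg Eh g≢h ; a≢c = ends-≢ Eg Ek g≢k ; b≢c = ends-≢ Eh Ek h≢k
      ; at-v = λ x∈ v∈x → case to x∈ v∈x of λ
          { (here eq) → inj₁ eq ; (there (here eq)) → inj₂ (inj₁ eq) ; (there (there (here eq))) → inj₂ (inj₂ eq) } }
      where
      g∈ = from (here refl)
      h∈ = from (there (here refl))
      k∈ = from (there (there (here refl)))
      Eg = proj₂ (ends (proj₂ g∈))
      Eh = proj₂ (ends (proj₂ h∈))
      Ek = proj₂ (ends (proj₂ k∈))

    step : Solution E
    step with any? (λ v → (degree′ v ≟ℕ 2) ⊎-dec (degree′ v ≟ℕ 3)) vertices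
    ... | yes thin with find thin
    ...   | v , _ , deg = thin-vertex (filter (v ∈ᵥ?_) E) (Unique.filter⁺ (v ∈ᵥ?_) E-unique)
              (∈-filter⁻ (v ∈ᵥ?_)) (∈-filter⁺ (v ∈ᵥ?_)) deg
    step | no none = owners-solution (Orient.owners (λ v → sparse (degree′ v) (λ eq → none (lose (∈-vertices v) eq))))
      where
      sparse : ∀ k → ¬ (k ≡ 2 ⊎ k ≡ 3) → k ≤ 1 ⊎ 4 ≤ k
      sparse 0 _ = inj₁ z≤n
      sparse 1 _ = inj₁ (s≤s z≤n)
      sparse 2 k≢ = ⊥-elim (k≢ (inj₁ refl))
      sparse 3 k≢ = ⊥-elim (k≢ (inj₂ refl))
      sparse (suc (suc (suc (suc k)))) _ = inj₂ (s≤s (s≤s (s≤s (s≤s z≤n))))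

  solve : ∀ n E → length E < n → Unique E → Proper E → Solution E
  solve (suc n) E (s≤s E≤n) E-unique proper = Reduction.step record
    { E = E ; E-unique = E-unique ; proper = proper
    ; rec = λ E′ u p E′<E → solve n E′ (≤-trans E′<E E≤n) u p }

-- Translation to finite simple graphs.

module _ {n : ℕ} where

  _∈ₑ_ : Fin n → Edge n → Set
  v ∈ₑ (p , q) = p Fin.< q × (p ≡ v ⊎ q ≡ v)

  ordered-ends : ∀ {p q} → p Fin.< q → Ends _∈ₑ_ (p , q) p q
  ordered-ends p<q = mkEnds (p<q , inj₁ refl) (p<q , inj₂ refl) (λ { refl → Fin.<-irrefl refl p<q })
    (λ { (_ , inj₁ refl) → inj₁ refl ; (_ , inj₂ refl) → inj₂ refl })

  -- A pair that is not increasing has no ends, so (z , z) serves as null.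
  incidence : Fin n → Incidence
  incidence z = record
    { _≟ᵥ_ = Fin._≟_
    ; _≟_ = ≡-dec Fin._≟_ Fin._≟_
    ; _∈ᵥ_ = _∈ₑ_
    ; _∈ᵥ?_ = λ { v (p , q) → (p Fin.<? q) ×-dec ((p Fin.≟ v) ⊎-dec (q Fin.≟ v)) }
    ; shape = shape
    ; simple = simple
    ; null = z , z
    ; null-empty = λ { (z<z , _) → Fin.<-irrefl refl z<z }
    ; vertices = allFin n
    ; vertices-unique = Unique.allFin⁺ n
    ; ∈-vertices = ∈-allFin
    }
    where
    shape : ∀ e → (∀ {p} → ¬ p ∈ₑ e) ⊎ ∃₂ (Ends _∈ₑ_ e)
    shape (p , q) with p Fin.<? q
    ... | yes p<q = inj₂ (p , q , ordered-ends p<q)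
    ... | no p≮q = inj₁ (λ v∈ → p≮q (proj₁ v∈))
    simple : ∀ {e f p q} → p ≢ q → p ∈ₑ e → q ∈ₑ e → p ∈ₑ f → q ∈ₑ f → e ≡ f
    simple p≢q (_ , inj₁ refl) (_ , inj₁ refl) _ _ = ⊥-elim (p≢q refl)
    simple p≢q (_ , inj₂ refl) (_ , inj₂ refl) _ _ = ⊥-elim (p≢q refl)
    simple p≢q _ _ (_ , inj₁ refl) (_ , inj₁ refl) = ⊥-elim (p≢q refl)
    simple p≢q _ _ (_ , inj₂ refl) (_ , inj₂ refl) = ⊥-elim (p≢q refl)
    simple _ (_ , inj₁ refl) (_ , inj₂ refl) (_ , inj₁ refl) (_ , inj₂ refl) = refl
    simple _ (_ , inj₂ refl) (_ , inj₁ refl) (_ , inj₂ refl) (_ , inj₁ refl) = refl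
    simple _ (p<q , inj₁ refl) (_ , inj₂ refl) (q<p , inj₂ refl) (_ , inj₁ refl) = ⊥-elim (Fin.<-asym p<q q<p)
    simple _ (q<p , inj₂ refl) (_ , inj₁ refl) (p<q , inj₁ refl) (_ , inj₂ refl) = ⊥-elim (Fin.<-asym p<q q<p)

module _ {n : ℕ} (G : SimpleGraph n) (no-isolated : NoIsolatedEdge G) (z : Fin n) where

  open WeakLocation (incidence z)

  increasing : ∀ {e} → e ∈ edges G → proj₁ e Fin.< proj₂ e
  increasing = All.lookup (ordered G)

  share→~ : ∀ {e f} → e ∈ edges G → f ∈ edges G → ShareEnd G e f → e ~ f
  share→~ e∈ f∈ (inj₁ p∈f) = _ , (increasing e∈ , inj₁ refl) , (increasing f∈ , p∈f)
  share→~ e∈ f∈ (inj₂ q∈f) = _ , (increasing e∈ , inj₂ refl) , (increasing f∈ , q∈f)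

  ~→share : ∀ {e f} → e ~ f → ShareEnd G e f
  ~→share (_ , (_ , inj₁ refl) , (_ , v∈f)) = inj₁ v∈f
  ~→share (_ , (_ , inj₂ refl) , (_ , v∈f)) = inj₂ v∈f

  S : Solution (edges G)
  S = solve _ (edges G) ≤-refl (unique G) (λ e∈ → _ , _ , ordered-ends (increasing e∈))

  open Solution S

  degree-one : ∀ {v e} → e ∈ edges G → Incident G v e →
    (∀ {x} → x ∈ edges G → Incident G v x → x ≡ e) → degree G v ≡ 1
  degree-one {v} {e} e∈ v∈e alone = singleton (Unique.filter⁺ (incident? G v) (unique G))
    (∈-filter⁺ (incident? G v) e∈ v∈e)
    (λ x∈ → let x∈E , v∈x = ∈-filter⁻ (incident? G v) {xs = edges G} x∈ in alone x∈E v∈x)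
    where
    singleton : ∀ {L : List (Edge n)} → Unique L → e ∈ L → (∀ {x} → x ∈ L → x ≡ e) → length L ≡ 1
    singleton {_ ∷ []} _ _ _ = refl
    singleton {_ ∷ _ ∷ _} ((x≢y ∷ _) ∷ _) _ same = ⊥-elim (x≢y (trans (same (here refl)) (sym (same (there (here refl))))))

  -- An undominated edge has the trace of `null`, so goodness leaves it without neighbours. Both of
  -- its ends then have degree 1, and the edge is isolated in `G`.
  dominating : IsEdgeDominating G D
  dominating e e∈ e∉ with any? (λ d → e ~? d) D
  ... | yes found with find found
  ...   | d , d∈ , e~d = d , d∈ , ~→share e~d
  dominating e e∈ e∉ | no none = ⊥-elim (no-isolated e
      (e∈ , degree-one e∈ (inj₁ refl) (λ x∈ p∈x → alone x∈ (share→~ e∈ x∈ (inj₁ p∈x)))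
          , degree-one e∈ (inj₂ refl) (λ x∈ q∈x → alone x∈ (share→~ e∈ x∈ (inj₂ q∈x)))))
    where
    empty : ∀ {d} → ¬ d ~ (z , z)
    empty (_ , _ , (z<z , _)) = Fin.<-irrefl refl z<z
    null∉ : (z , z) ∉ edges G
    null∉ z∈ = Fin.<-irrefl refl (increasing z∈)
    same : Same D e (z , z)
    same d∈ = (λ d~e → ⊥-elim (none (lose d∈ (~-sym d~e)))) , (λ d~z → ⊥-elim (empty d~z))
    alone : ∀ {x} → x ∈ edges G → e ~ x → x ≡ e
    alone {x} x∈ e~x with ≡-dec Fin._≟_ Fin._≟_ x e
    ... | yes eq = eq
    ... | no x≢e = ⊥-elim (empty (good (there e∈) (here refl) e∉ (null∉ ∘ D⊆E) same x∈ x≢e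
                     (λ { refl → null∉ x∈ }) (~-sym e~x)))

  -- Equal traces make the neighbourhoods agree away from `e` and `f`. Whether `e` and `f` touch
  -- decides between closed and open twins.
  locating : ∀ e f → e ∈ edges G → f ∈ edges G → e ∉ D → f ∉ D → e ≢ f → ¬ EdgeTwins G e f → ¬ SameTrace G D e f
  locating e f e∈ f∈ e∉ f∉ e≢f no-twins same-trace = no-twins (twins (e ~? f))
    where
    half : ∀ {e f d} → e ∈ edges G → e ∉ D → d ∈ D → (InN G e d → InN G f d) → f ∈ edges G → d ~ e → d ~ f
    half e∈ e∉ d∈ to f∈ d~e with to (D⊆E d∈ , (λ { refl → e∉ d∈ }) , ~→share (~-sym d~e))
    ... | _ , _ , share = ~-sym (share→~ f∈ (D⊆E d∈) share)
    same : Same D e f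
    same d∈ = half e∈ e∉ d∈ (Equivalence.to (same-trace _ d∈)) f∈ , half f∈ f∉ d∈ (Equivalence.from (same-trace _ d∈)) e∈
    across : ∀ {e f g} → e ∈ edges G → f ∈ edges G → e ∉ D → f ∉ D → Same D e f →
      g ≢ f → InN G e g → InN G f g
    across e∈ f∈ e∉ f∉ same g≢f (g∈ , g≢e , share) =
      g∈ , g≢f , ~→share (~-sym (good (there e∈) (there f∈) e∉ f∉ same g∈ g≢e g≢f (~-sym (share→~ e∈ g∈ share))))
    e→f : ∀ {g} → g ≢ f → InN G e g → InN G f g
    e→f = across e∈ f∈ e∉ f∉ same
    f→e : ∀ {g} → g ≢ e → InN G f g → InN G e g
    f→e = across f∈ e∈ f∉ e∉ (same-sym same)
    twins : Dec (e ~ f) → EdgeTwins G e f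
    twins (no e≁f) = inj₁ λ g → mk⇔
      (λ { N@(_ , _ , share) → e→f (λ { refl → e≁f (share→~ e∈ f∈ share) }) N })
      (λ { N@(_ , _ , share) → f→e (λ { refl → e≁f (~-sym (share→~ f∈ e∈ share)) }) N })
    twins (yes e~f) = inj₂ λ g → mk⇔
      (λ { (inj₁ refl) → inj₂ (e∈ , e≢f , ~→share (~-sym e~f))
         ; (inj₂ N) → closed f (e→f {g}) N })
      (λ { (inj₁ refl) → inj₂ (f∈ , ≢-sym e≢f , ~→share e~f)
         ; (inj₂ N) → closed e (f→e {g}) N })
      where
      closed : ∀ {e g} f → (g ≢ f → InN G e g → InN G f g) → InN G e g → InN[] G f g
      closed {g = g} f to N with ≡-dec Fin._≟_ Fin._≟_ g f
      ... | yes eq = inj₁ eq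
      ... | no g≢f = inj₂ (to g≢f N)

  weak-ELD : Σ[ D ∈ List (Edge n) ] (IsWeakELD G D × 2 * length D ≤ size G)
  weak-ELD = D , ((All.tabulate D⊆E , D-unique) , dominating , locating) , small

theorem1 : (n : ℕ) (G : SimpleGraph n) → NoIsolatedEdge G →
    Σ[ D ∈ List (Edge n) ] (IsWeakELD G D × 2 * length D ≤ size G)
-- Without vertices there is no pair that could serve as `null`, but there are no edges either.
theorem1 zero G no-isolated = [] , (([] , []) , (λ { (() , _) }) , (λ { (() , _) })) , z≤n
theorem1 (suc n) G no-isolated = weak-ELD G no-isolated zero
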